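{- Let $n$ be odd and let $X=(X_{ij})$ be the $n\times n$ matrix of indeterminates. Then $AT(n)\cdot(R_n^{\mathrm{E}}-R_n^{\mathrm{O}})$ is the coefficient of $(-1)^{\frac{n(n-1)}{2}}\prod_{i=1}^n\prod_{j=1}^nX_{ij}$ in \[ \frac{1}{n!\,(n-1)!^2}\sum_{\substack{\rho,\sigma\in\mathrm{Sym}(n)^n\\ \rho_1=\mathrm{id}}}\epsilon(\sigma_1)\epsilon(\sigma)\epsilon(\rho)\prod_{i,j=1}^nX_{\sigma_i(j),\rho_j(i)}; \] that is, the coefficient of the monomial $\prod_{i,j}X_{ij}$ in this polynomial equals $(-1)^{\frac{n(n-1)}{2}}AT(n)(R_n^{\mathrm{E}}-R_n^{\mathrm{O}})$.
   Context: $\mathrm{Sym}(n)$ is the symmetric group on $[n]=\{1,\dots,n\}$ and $\epsilon(\pi)$ the sign of $\pi$. For $\sigma=(\sigma_1,\dots,\sigma_n)\in\mathrm{Sym}(n)^n$, $\sigma_1$ is its first component and $\epsilon(\sigma)=\prod_{i=1}^n\epsilon(\sigma_i)$ (similarly for $\rho$). A Latin square of order $n$ is an $n\times n$ array with entries in $[n]$ in which each number appears exactly once in each row and each column. Viewing rows and columns as permutations of $[n]$, the sign of a Latin square is the product of the signs of all its rows and all its columns; it is even if its sign is $1$ and odd if $-1$. A Latin square is normalized if its first row is the identity permutation, unipotent if all entries on its main diagonal are equal, and reduced if its first row and first column are the identity permutation. $AT(n)=U_n^{\mathrm{E}}-U_n^{\mathrm{O}}$, where $U_n^{\mathrm{E}}$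 ($U_n^{\mathrm{O}}$) is the number of normalized unipotent even (odd) Latin squares of order $n$; $R_n^{\mathrm{E}}$ ($R_n^{\mathrm{O}}$) is the number of even (odd) reduced Latin squares of order $n$. -}

module Defs where

open import Data.Bool using (Bool; true; false; _∧_; _∨_; not; if_then_else_)
open import Data.Nat using (ℕ; zero; suc; _∸_; _<ᵇ_; _≡ᵇ_; _!)
import Data.Nat as ℕ
open import Data.Nat.Properties using (_!≢0; m*n≢0)
open import Data.Fin using (Fin; toℕ)
open import Data.Vec using (Vec; []; _∷_; lookup; tabulate)
open import Data.List using (List; []; _∷_; map; concatMap; length; foldr; allFin)
open import Data.Product using (_×_; _,_; proj₁; proj₂)
open import Data.Integer using (ℤ; +_; -1ℤ; 1ℤ)
import Data.Integer as ℤ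
open import Data.Rational using (ℚ; 0ℚ)
import Data.Rational as ℚ
open import Relation.Nullary using (does)
open import Function using (id)

select : {A : Set} → (A → Bool) → List A → List A
select p []       = []
select p (x ∷ xs) = if p x then x ∷ select p xs else select p xs

allL : {A : Set} → List A → (A → Bool) → Bool
allL xs p = foldr (λ x b → p x ∧ b) true xs

vecsOver : {A : Set} → List A → (k : ℕ) → List (Vec A k)
vecsOver xs zero    = [] ∷ []
vecsOver xs (suc k) = concatMap (λ x → map (x ∷_) (vecsOver xs k)) xs

prodℤ : List ℤ → ℤ
prodℤ = foldr ℤ._*_ 1ℤ

sumℚ : List ℚ → ℚ
sumℚ = foldr ℚ._+_ 0ℚ

_==_ : {n : ℕ} → Fin n → Fin n → Bool
a == b = toℕ a ≡ᵇ toℕ b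

-- "i is the first index" (i.e. i = 1 in the paper's 1-based indexing)
isFirst : {n : ℕ} → Fin n → Bool
isFirst i = toℕ i ≡ᵇ 0

-- Permutations of [n] = Fin n : the map i ↦ lookup π i, required bijective
-- (injective self-maps of a finite set)

Perm : ℕ → Set
Perm n = Vec (Fin n) n

injectiveᵇ : {n : ℕ} → Vec (Fin n) n → Bool
injectiveᵇ {n} π =
  allL (allFin n) λ i → allL (allFin n) λ j →
    (i == j) ∨ not (lookup π i == lookup π j)

Sym : (n : ℕ) → List (Perm n)
Sym n = select injectiveᵇ (vecsOver (allFin n) n)

idPerm : (n : ℕ) → Perm n
idPerm n = tabulate id

samePerm : {n : ℕ} → Perm n → Perm n → Bool
samePerm {n} π τ = allL (allFin n) λ i → lookup π i == lookup τ i

inversions : {n : ℕ} → Perm n → ℕ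
inversions {n} π =
  length (concatMap (λ a → select (λ b → (toℕ a <ᵇ toℕ b) ∧
                                         (toℕ (lookup π b) <ᵇ toℕ (lookup π a)))
                                  (allFin n))
                    (allFin n))

sign : {n : ℕ} → Perm n → ℤ
sign π = -1ℤ ℤ.^ inversions π

signTuple : {n : ℕ} → Vec (Perm n) n → ℤ
signTuple {n} σ = prodℤ (map (λ i → sign (lookup σ i)) (allFin n))

signFirst : {n : ℕ} → Vec (Perm n) n → ℤ
signFirst {n} σ =
  prodℤ (map (λ i → sign (lookup σ i)) (select isFirst (allFin n)))

firstIsId : {n : ℕ} → Vec (Perm n) n → Bool
firstIsId {n} ρ = allL (allFin n) λ i → not (isFirst i) ∨ samePerm (lookup ρ i) (idPerm n)

Array : ℕ → Set
Array n = Vec (Vec (Fin n) n) n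

rowOf : {n : ℕ} → Array n → Fin n → Perm n
rowOf L i = lookup L i

colOf : {n : ℕ} → Array n → Fin n → Perm n
colOf L j = tabulate (λ i → lookup (lookup L i) j)

isLatinᵇ : {n : ℕ} → Array n → Bool
isLatinᵇ {n} L =
  allL (allFin n) (λ i → injectiveᵇ (rowOf L i)) ∧
  allL (allFin n) (λ j → injectiveᵇ (colOf L j))

LatinSquares : (n : ℕ) → List (Array n)
LatinSquares n = select isLatinᵇ (vecsOver (vecsOver (allFin n) n) n)

signLS : {n : ℕ} → Array n → ℤ
signLS {n} L =
  prodℤ (map (λ i → sign (rowOf L i)) (allFin n)) ℤ.*
  prodℤ (map (λ j → sign (colOf L j)) (allFin n))

isEvenLS : {n : ℕ} → Array n → Bool
isEvenLS L = does (signLS L ℤ.≟ 1ℤ)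

isOddLS : {n : ℕ} → Array n → Bool
isOddLS L = does (signLS L ℤ.≟ -1ℤ)

isNormalized : {n : ℕ} → Array n → Bool
isNormalized {n} L = allL (allFin n) λ i → not (isFirst i) ∨ samePerm (rowOf L i) (idPerm n)

firstColId : {n : ℕ} → Array n → Bool
firstColId {n} L = allL (allFin n) λ j → not (isFirst j) ∨ samePerm (colOf L j) (idPerm n)

isUnipotent : {n : ℕ} → Array n → Bool
isUnipotent {n} L =
  allL (allFin n) λ i → allL (allFin n) λ j →
    lookup (lookup L i) i == lookup (lookup L j) j

isReduced : {n : ℕ} → Array n → Bool
isReduced L = isNormalized L ∧ firstColId L

U-E U-O R-E R-O : ℕ → ℕ
U-E n = length (select (λ L → isNormalized L ∧ isUnipotent L ∧ isEvenLS L) (LatinSquares n))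
U-O n = length (select (λ L → isNormalized L ∧ isUnipotent L ∧ isOddLS L) (LatinSquares n))
R-E n = length (select (λ L → isReduced L ∧ isEvenLS L) (LatinSquares n))
R-O n = length (select (λ L → isReduced L ∧ isOddLS L) (LatinSquares n))

AT : ℕ → ℤ
AT n = (+ U-E n) ℤ.- (+ U-O n)

-- Polynomials in the n² indeterminates X_{ab} (a, b ∈ [n]) with ℚ coefficients,
-- represented as formal finite sums of terms c · X^e.

Monomial : ℕ → Set
Monomial n = Fin n → Fin n → ℕ          -- exponent of X_{ab}

Poly : ℕ → Set
Poly n = List (ℚ × Monomial n)

sameMonomial : {n : ℕ} → Monomial n → Monomial n → Bool
sameMonomial {n} e f = allL (allFin n) λ a → allL (allFin n) λ b → e a b ≡ᵇ f a b

coeff : {n : ℕ} → Poly n → Monomial n → ℚ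
coeff p e = sumℚ (map proj₁ (select (λ t → sameMonomial (proj₂ t) e) p))

varProduct : {n : ℕ} → List (Fin n × Fin n) → Monomial n
varProduct xs a b = length (select (λ p → (proj₁ p == a) ∧ (proj₂ p == b)) xs)

scale : {n : ℕ} → ℚ → Poly n → Poly n
scale c = map (λ t → c ℚ.* proj₁ t , proj₂ t)

allVars : (n : ℕ) → Monomial n
allVars n a b = 1

term : {n : ℕ} → Vec (Perm n) n → Vec (Perm n) n → ℚ × Monomial n
term {n} ρ σ =
  (signFirst σ ℤ.* signTuple σ ℤ.* signTuple ρ) ℚ./ 1 ,
  varProduct (concatMap (λ i → map (λ j → lookup (lookup σ i) j , lookup (lookup ρ j) i)
                                   (allFin n))
                        (allFin n))

normConst : ℕ → ℕ
normConst n = n ! ℕ.* (n ∸ 1) ! ℕ.* (n ∸ 1) !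

invNormConst : ℕ → ℚ
invNormConst n = (1ℤ ℚ./ normConst n) {{nz}}
  where
  nz = m*n≢0 (n ! ℕ.* (n ∸ 1) !) ((n ∸ 1) !)
         {{m*n≢0 (n !) ((n ∸ 1) !) {{n !≢0}} {{(n ∸ 1) !≢0}}}} {{(n ∸ 1) !≢0}}

thePoly : (n : ℕ) → Poly n
thePoly n =
  scale (invNormConst n)
    (concatMap (λ ρ → map (λ σ → term ρ σ) (vecsOver (Sym n) n))
               (select firstIsId (vecsOver (Sym n) n)))

{-# OPTIONS --safe #-}

-- View ρ as the array with rows ρ_j. For fixed ρ the sum over σ_i with i ≠ 1 is a determinant of
-- columns of X selected by column i of ρ; it vanishes unless these columns are distinct, so only
-- Latin ρ contribute, and then replacing σ_i by σ_i composed with column i of ρ splits the sum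
-- into (Σ over Latin ρ) · (Σ over Latin σ), where rows and columns of index 1 carry no sign.
-- As n is odd, permuting the rows (columns) of a Latin square does not change the sign of its
-- n - 1 non-first columns (rows): the first factor is (n-1)! times the sum over reduced squares,
-- the second is n! times the sum of the row signs of the normalized squares. The row, column
-- and symbol signs of a Latin square multiply to (-1)^(n(n-1)/2), so exchanging rows with
-- symbols turns that sum into the signed count of the squares with first symbol on the diagonal,
-- which is (n-1)! AT(n) by permuting the symbols.

module Submission where

open import Defs
open import Data.Bool using (Bool; true; false; _∧_; _∨_; not; if_then_else_)
open import Data.Bool.Properties using (T-≡; ∧-assoc)
open import Data.Empty using (⊥-elim)
open import Data.Fin using (Fin; zero; suc; toℕ; punchIn; punchOut; combine; remQuot)
import Data.Fin.Properties as Finₚ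
open import Data.Integer using (ℤ; +_; -_; -1ℤ; 0ℤ; 1ℤ; _+_; _*_; _^_)
import Data.Integer as ℤ
import Data.Integer.Properties as ℤₚ
open import Data.Integer.Tactic.RingSolver using (solve-∀)
open import Data.List using (List; []; _∷_; _++_; map; concatMap; length; allFin; cartesianProduct; cartesianProductWith)
import Data.List as List
import Data.List.Properties as Listₚ
open import Data.List.Membership.Propositional using (_∈_)
open import Data.List.Membership.Propositional.Properties using (∈-map⁺; ∈-map⁻; ∈-allFin; ∈-cartesianProductWith⁺; ∈-cartesianProductWith⁻; ∈-cartesianProduct⁺; ∈-cartesianProduct⁻)
open import Data.List.Membership.Propositional.Properties.WithK using (unique∧set⇒bag)
open import Data.List.Relation.Binary.BagAndSetEquality using (∼bag⇒↭)
open import Data.List.Relation.Binary.Permutation.Propositional using (_↭_; prep; swap; ↭⇒↭ₛ; ↭-trans; ↭-reflexive)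
import Data.List.Relation.Binary.Permutation.Propositional as Perm
open import Data.List.Relation.Binary.Permutation.Propositional.Properties using (↭-length)
import Data.List.Relation.Binary.Permutation.Propositional.Properties as Permₚ
open import Data.List.Relation.Binary.Permutation.Setoid.Properties using (foldr-commMonoid)
open import Data.List.Relation.Unary.All using (All; []; _∷_)
import Data.List.Relation.Unary.All as All
open import Data.List.Relation.Unary.AllPairs using (AllPairs; []; _∷_)
open import Data.List.Relation.Unary.Any using (here; there)
open import Data.List.Relation.Unary.Unique.Propositional using (Unique)
import Data.List.Relation.Unary.Unique.Propositional.Properties as Unique
open import Data.Nat using (ℕ; zero; suc; _!; _∸_; _%_; _/_; _<ᵇ_; NonZero)
import Data.Nat as ℕ
open import Data.Nat.DivMod using (m≡m%n+[m/n]*n; m*n/n≡m)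
import Data.Nat.Properties as ℕₚ
import Data.Nat.Tactic.RingSolver as ℕ-Solver
open import Data.Product using (_×_; _,_; proj₁; proj₂; ∃; uncurry)
open import Data.Rational using (ℚ; toℚᵘ)
import Data.Rational as ℚ
import Data.Rational.Properties as ℚₚ
open import Data.Rational.Unnormalised using (mkℚᵘ; *≡*) renaming (_≃_ to _≃ᵘ_; _+_ to _+ᵘ_; _*_ to _*ᵘ_)
import Data.Rational.Unnormalised.Properties as ℚᵘₚ
open import Data.Sum using (_⊎_; inj₁; inj₂)
open import Data.Unit using (⊤)
open import Data.Vec using (Vec; []; _∷_; lookup; tabulate)
import Data.Vec.Properties as Vecₚ
open import Function using (_∘_; id; _⇔_; mk⇔; Equivalence)
open import Relation.Binary.PropositionalEquality using (_≡_; _≢_; refl; sym; trans; cong; cong₂; subst; module ≡-Reasoning)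
open import Relation.Binary.PropositionalEquality.Properties using (setoid)
import Relation.Binary.Reasoning.Setoid as ≃-Reasoning
open import Relation.Nullary using (yes; no; does; contradiction; _×-dec_; ¬?)
open Equivalence using (to; from)

-- The factor `signFirst` cancels the sign of σ_1, so index 1 contributes a permanent and not a
-- determinant: equal columns produce no cancellation there. The determinants therefore only force
-- the columns of ρ other than the first to be permutations, and a separate count (`clash⊎Latin`)
-- supplies the first one.
--
-- No polynomial identity is expanded. The monomial of (ρ, σ) is the product of all variables
-- exactly when the n² pairs (σ_i(j), ρ_j(i)) are distinct. The coefficient is thus a signed sum
-- over pairs of arrays, and both properties of determinants, vanishing on equal columns and the
-- sign under a permutation of columns, become changes of variables in σ.
--
-- Every class of arrays is described by a predicate, so that an identity between sums reduces to a
-- bijection with a check of weights. Signs are rewritten from inversion counts to products of order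
-- comparisons over unordered pairs; composition, transpositions and the relation between row,
-- column and symbol signs are then statements about reindexing pairs.

private variable
  X Y Z : Set
  n m : ℕ

-- Enumerations

infix 4 _enumerates_
-- Duplicate-free lists with the same members are permutations of each other, so a sum over such a
-- list depends only on the predicate `P`.
record _enumerates_ {X : Set} (xs : List X) (P : X → Set) : Set where
  constructor enumeration
  field
    unique   : Unique xs
    sound    : ∀ {x} → x ∈ xs → P x
    complete : ∀ {x} → P x → x ∈ xs
open _enumerates_

enumerates-⇔ : {xs : List X} {P Q : X → Set} → (∀ x → P x ⇔ Q x) → xs enumerates P → xs enumerates Q
enumerates-⇔ P⇔Q e = enumeration (unique e) (Equivalence.to (P⇔Q _) ∘ sound e) (complete e ∘ Equivalence.from (P⇔Q _))

enumerates⇒↭ : {xs ys : List X} {P : X → Set} → xs enumerates P → ys enumerates P → xs ↭ ys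
enumerates⇒↭ e f = ∼bag⇒↭ (unique∧set⇒bag (unique e) (unique f)
  (mk⇔ (complete f ∘ sound e) (complete e ∘ sound f)))

map-unique : (f : X → Y) {xs : List X} → (∀ {x y} → x ∈ xs → y ∈ xs → f x ≡ f y → x ≡ y) →
             Unique xs → Unique (map f xs)
map-unique f inj []       = []
map-unique f {x ∷ xs} inj (p ∷ u) =
  All.tabulate (λ y∈ fx≡y → let (z , z∈ , y≡fz) = ∈-map⁻ f y∈ in
    All.lookup p z∈ (inj (here refl) (there z∈) (trans fx≡y y≡fz)))
  ∷ map-unique f (λ x∈ y∈ → inj (there x∈) (there y∈)) u

-- The maps are inverse to each other only on `P` and `Q`, because those built from `inv` can be
-- inverted only when the rows or columns concerned are injective.
map-enumerates : {xs : List X} {P : X → Set} {Q : Y → Set} (φ : X → Y) (ψ : Y → X) →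
  (∀ x → P x → Q (φ x)) → (∀ y → Q y → P (ψ y)) →
  (∀ x → P x → ψ (φ x) ≡ x) → (∀ y → Q y → φ (ψ y) ≡ y) →
  xs enumerates P → map φ xs enumerates Q
map-enumerates {xs = xs} {Q = Q} φ ψ to from ψφ φψ e = enumeration
  (map-unique φ (λ x∈ y∈ eq → trans (sym (ψφ _ (sound e x∈))) (trans (cong ψ eq) (ψφ _ (sound e y∈)))) (unique e))
  (λ y∈ → let (x , x∈ , eq) = ∈-map⁻ φ y∈ in subst Q (sym eq) (to _ (sound e x∈)))
  (λ {y} q → subst (_∈ map φ xs) (φψ y q) (∈-map⁺ φ (complete e (from y q))))

allFin-enumerates : ∀ n → allFin n enumerates (λ _ → ⊤)
allFin-enumerates n = enumeration (Unique.allFin⁺ n) _ (λ {i} _ → ∈-allFin i)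

cartesianProduct-enumerates : {xs : List X} {ys : List Y} {P : X → Set} {Q : Y → Set} →
  xs enumerates P → ys enumerates Q →
  cartesianProduct xs ys enumerates (λ z → P (proj₁ z) × Q (proj₂ z))
cartesianProduct-enumerates {xs = xs} {ys} e f = enumeration
  (Unique.cartesianProduct⁺ (unique e) (unique f))
  (λ z∈ → let (x∈ , y∈) = ∈-cartesianProduct⁻ xs ys z∈ in sound e x∈ , sound f y∈)
  (λ (p , q) → ∈-cartesianProduct⁺ (complete e p) (complete f q))

∈-select⁻ : (p : X → Bool) (xs : List X) {x : X} → x ∈ select p xs → x ∈ xs × p x ≡ true
∈-select⁻ p (y ∷ ys) x∈ with p y in eq
∈-select⁻ p (y ∷ ys) (here refl) | true  = here refl , eq
∈-select⁻ p (y ∷ ys) (there x∈)  | true  = let (q , r) = ∈-select⁻ p ys x∈ in there q , r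
∈-select⁻ p (y ∷ ys) x∈          | false = let (q , r) = ∈-select⁻ p ys x∈ in there q , r

∈-select⁺ : (p : X → Bool) {xs : List X} {x : X} → x ∈ xs → p x ≡ true → x ∈ select p xs
∈-select⁺ p {y ∷ ys} (here refl) px rewrite px = here refl
∈-select⁺ p {y ∷ ys} (there x∈) px with p y
... | true  = there (∈-select⁺ p x∈ px)
... | false = ∈-select⁺ p x∈ px

select-unique : (p : X → Bool) {xs : List X} → Unique xs → Unique (select p xs)
select-unique p []       = []
select-unique p {x ∷ xs} (q ∷ u) with p x
... | true  = All.tabulate (λ y∈ → All.lookup q (proj₁ (∈-select⁻ p xs y∈))) ∷ select-unique p u
... | false = select-unique p u

select-enumerates : {p : X → Bool} {xs : List X} {P Q : X → Set} → (∀ x → p x ≡ true ⇔ Q x) →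
  xs enumerates P → select p xs enumerates (λ x → P x × Q x)
select-enumerates {p = p} {xs} p⇔Q e = enumeration
  (select-unique p (unique e))
  (λ x∈ → let (y , z) = ∈-select⁻ p xs x∈ in sound e y , Equivalence.to (p⇔Q _) z)
  (λ (x , q) → ∈-select⁺ p (complete e x) (Equivalence.from (p⇔Q _) q))

concatMap-map : (f : X → Y → Z) (xs : List X) (ys : List Y) →
  concatMap (λ x → map (f x) ys) xs ≡ cartesianProductWith f xs ys
concatMap-map f []       ys = refl
concatMap-map f (x ∷ xs) ys = cong (map (f x) ys ++_) (concatMap-map f xs ys)

map-cartesianProductWith : (g : Z → X) {D : Set} (f : Y → D → Z) (xs : List Y) (ys : List D) →
  map g (cartesianProductWith f xs ys) ≡ cartesianProductWith (λ x y → g (f x y)) xs ys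
map-cartesianProductWith g f []       ys = refl
map-cartesianProductWith g f (x ∷ xs) ys = trans (Listₚ.map-++ g (map (f x) ys) _)
  (cong₂ _++_ (sym (Listₚ.map-∘ ys)) (map-cartesianProductWith g f xs ys))

vecsOver-enumerates : {xs : List X} {P : X → Set} → xs enumerates P → ∀ k →
  vecsOver xs k enumerates (λ v → ∀ i → P (lookup v i))
vecsOver-enumerates e zero = enumeration ([] ∷ []) (λ _ ()) (λ { {[]} _ → here refl })
vecsOver-enumerates {xs = xs} {P} e (suc k)
  rewrite concatMap-map {Z = Vec _ (suc k)} _∷_ xs (vecsOver xs k) = enumeration
  (Unique.cartesianProductWith⁺ _∷_ (λ { refl → refl , refl }) (unique e) (unique ih))
  snd
  (λ { {x ∷ v} ps → ∈-cartesianProductWith⁺ _∷_ (complete e (ps zero)) (complete ih (ps ∘ suc)) })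
  where
  ih = vecsOver-enumerates e k
  snd : ∀ {v} → v ∈ cartesianProductWith _∷_ xs (vecsOver xs k) → ∀ i → P (lookup v i)
  snd v∈ i with ∈-cartesianProductWith⁻ _∷_ xs (vecsOver xs k) v∈
  snd v∈ zero    | x , w , x∈ , w∈ , refl = sound e x∈
  snd v∈ (suc i) | x , w , x∈ , w∈ , refl = sound ih w∈ i

-- Sums and products over lists

∑ : List X → (X → ℤ) → ℤ
∑ xs f = List.foldr _+_ 0ℤ (map f xs)

∏ : List X → (X → ℤ) → ℤ
∏ xs f = prodℤ (map f xs)

∑-cong : (xs : List X) {f g : X → ℤ} → (∀ {x} → x ∈ xs → f x ≡ g x) → ∑ xs f ≡ ∑ xs g
∑-cong []       eq = refl
∑-cong (x ∷ xs) eq = cong₂ _+_ (eq (here refl)) (∑-cong xs (eq ∘ there))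

∏-cong : (xs : List X) {f g : X → ℤ} → (∀ x → f x ≡ g x) → ∏ xs f ≡ ∏ xs g
∏-cong []       eq = refl
∏-cong (x ∷ xs) eq = cong₂ _*_ (eq x) (∏-cong xs eq)

∑-map : (φ : X → Y) (xs : List X) (f : Y → ℤ) → ∑ (map φ xs) f ≡ ∑ xs (f ∘ φ)
∑-map φ xs f = cong (List.foldr _+_ 0ℤ) (sym (Listₚ.map-∘ xs))

∏-map : (φ : X → Y) (xs : List X) (f : Y → ℤ) → ∏ (map φ xs) f ≡ ∏ xs (f ∘ φ)
∏-map φ xs f = cong prodℤ (sym (Listₚ.map-∘ xs))

∑-↭ : {xs ys : List X} (f : X → ℤ) → xs ↭ ys → ∑ xs f ≡ ∑ ys f
∑-↭ f p = foldr-commMonoid (setoid ℤ) ℤₚ.+-0-isCommutativeMonoid (↭⇒↭ₛ (Permₚ.map⁺ f p))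

∏-↭ : {xs ys : List X} (f : X → ℤ) → xs ↭ ys → ∏ xs f ≡ ∏ ys f
∏-↭ f p = foldr-commMonoid (setoid ℤ) ℤₚ.*-1-isCommutativeMonoid (↭⇒↭ₛ (Permₚ.map⁺ f p))

∑-++ : (xs ys : List X) (f : X → ℤ) → ∑ (xs ++ ys) f ≡ ∑ xs f + ∑ ys f
∑-++ []       ys f = sym (ℤₚ.+-identityˡ _)
∑-++ (x ∷ xs) ys f = trans (cong (λ z → f x + z) (∑-++ xs ys f)) (sym (ℤₚ.+-assoc (f x) _ _))

∏-++ : (xs ys : List X) (f : X → ℤ) → ∏ (xs ++ ys) f ≡ ∏ xs f * ∏ ys f
∏-++ []       ys f = sym (ℤₚ.*-identityˡ _)
∏-++ (x ∷ xs) ys f = trans (cong (f x *_) (∏-++ xs ys f)) (sym (ℤₚ.*-assoc (f x) _ _))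

∑-*ˡ : (c : ℤ) (xs : List X) (f : X → ℤ) → ∑ xs (λ x → c * f x) ≡ c * ∑ xs f
∑-*ˡ c []       f = sym (ℤₚ.*-zeroʳ c)
∑-*ˡ c (x ∷ xs) f = trans (cong (λ z → c * f x + z) (∑-*ˡ c xs f)) (sym (ℤₚ.*-distribˡ-+ c (f x) _))

∑-*ʳ : (c : ℤ) (xs : List X) (f : X → ℤ) → ∑ xs (λ x → f x * c) ≡ ∑ xs f * c
∑-*ʳ c xs f = trans (∑-cong xs (λ {x} _ → ℤₚ.*-comm (f x) c)) (trans (∑-*ˡ c xs f) (ℤₚ.*-comm c _))

private
  interchange : ∀ a b c d → (a * b) * (c * d) ≡ (a * c) * (b * d)
  interchange = solve-∀

∏-* : (xs : List X) (f g : X → ℤ) → ∏ xs (λ x → f x * g x) ≡ ∏ xs f * ∏ xs g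
∏-* []       f g = refl
∏-* (x ∷ xs) f g = trans (cong (f x * g x *_) (∏-* xs f g)) (interchange (f x) (g x) _ _)

∏-1 : (xs : List X) → ∏ xs (λ _ → 1ℤ) ≡ 1ℤ
∏-1 []       = refl
∏-1 (x ∷ xs) = trans (ℤₚ.*-identityˡ _) (∏-1 xs)

∑-select : (p : X → Bool) (xs : List X) (f : X → ℤ) →
  ∑ (select p xs) f ≡ ∑ xs (λ x → if p x then f x else 0ℤ)
∑-select p []       f = refl
∑-select p (x ∷ xs) f with p x
... | true  = cong (λ z → f x + z) (∑-select p xs f)
... | false = trans (∑-select p xs f) (sym (ℤₚ.+-identityˡ _))

∑-reindex : {xs : List X} {ys : List Y} {P : X → Set} {Q : Y → Set} →
  xs enumerates P → ys enumerates Q → (φ : X → Y) (ψ : Y → X) →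
  (∀ x → P x → Q (φ x)) → (∀ y → Q y → P (ψ y)) →
  (∀ x → P x → ψ (φ x) ≡ x) → (∀ y → Q y → φ (ψ y) ≡ y) →
  (f : Y → ℤ) (g : X → ℤ) → (∀ x → P x → f (φ x) ≡ g x) → ∑ ys f ≡ ∑ xs g
∑-reindex {xs = xs} e e′ φ ψ to from ψφ φψ f g fφ≡g = trans
  (∑-↭ f (enumerates⇒↭ e′ (map-enumerates φ ψ to from ψφ φψ e)))
  (trans (∑-map φ xs f) (∑-cong xs (λ x∈ → fφ≡g _ (sound e x∈))))

-- Source of the factorials: a square is encoded as a permutation together with a normal form, and
-- its weight depends on the normal form alone.
∑-cartesianProduct : (xs : List X) (ys : List Y) (f : Y → ℤ) →
  ∑ (cartesianProduct xs ys) (f ∘ proj₂) ≡ + length xs * ∑ ys f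
∑-cartesianProduct []       ys f = sym (ℤₚ.*-zeroˡ (∑ ys f))
∑-cartesianProduct (x ∷ xs) ys f = trans (∑-++ (map (x ,_) ys) _ (f ∘ proj₂))
  (trans (cong₂ _+_ (∑-map (x ,_) ys (f ∘ proj₂)) (∑-cartesianProduct xs ys f))
         (lem (∑ ys f) (+ length xs)))
  where
  lem : ∀ s l → s + l * s ≡ (1ℤ + l) * s
  lem = solve-∀

-- Products over unordered pairs of positions

∏₂ : List X → (X → X → ℤ) → ℤ
∏₂ []       h = 1ℤ
∏₂ (x ∷ xs) h = ∏ xs (h x) * ∏₂ xs h

-- The relation `R` is instantiated with `_≢_`, taken from the uniqueness of `allFin`: the factors
-- are signs only at distinct positions.
∏₂-cong : {R : X → X → Set} {xs : List X} {h h′ : X → X → ℤ} → AllPairs R xs →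
  (∀ x y → R x y → h x y ≡ h′ x y) → ∏₂ xs h ≡ ∏₂ xs h′
∏₂-cong []       eq = refl
∏₂-cong {xs = x ∷ xs} {h} {h′} (p ∷ ps) eq = cong₂ _*_ (go p) (∏₂-cong ps eq)
  where
  go : ∀ {ys} → All _ ys → ∏ ys (h x) ≡ ∏ ys (h′ x)
  go []       = refl
  go (q ∷ qs) = cong₂ _*_ (eq x _ q) (go qs)

∏₂-cong′ : (xs : List X) {h h′ : X → X → ℤ} → (∀ x y → h x y ≡ h′ x y) → ∏₂ xs h ≡ ∏₂ xs h′
∏₂-cong′ []       eq = refl
∏₂-cong′ (x ∷ xs) eq = cong₂ _*_ (∏-cong xs (eq x)) (∏₂-cong′ xs eq)

∏₂-* : (xs : List X) (h h′ : X → X → ℤ) →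
  ∏₂ xs (λ x y → h x y * h′ x y) ≡ ∏₂ xs h * ∏₂ xs h′
∏₂-* []       h h′ = refl
∏₂-* (x ∷ xs) h h′ = trans (cong₂ _*_ (∏-* xs (h x) (h′ x)) (∏₂-* xs h h′))
  (interchange (∏ xs (h x)) _ _ _)

∏₂-1 : (xs : List X) → ∏₂ xs (λ _ _ → 1ℤ) ≡ 1ℤ
∏₂-1 []       = refl
∏₂-1 (x ∷ xs) = cong₂ _*_ (∏-1 xs) (∏₂-1 xs)

∏₂-map : (φ : X → Y) (xs : List X) (h : Y → Y → ℤ) →
  ∏₂ (map φ xs) h ≡ ∏₂ xs (λ x y → h (φ x) (φ y))
∏₂-map φ []       h = refl
∏₂-map φ (x ∷ xs) h = cong₂ _*_ (∏-map φ xs (h (φ x))) (∏₂-map φ xs h)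

∏₂-↭ : {xs ys : List X} (h : X → X → ℤ) → (∀ x y → h x y ≡ h y x) → xs ↭ ys → ∏₂ xs h ≡ ∏₂ ys h
∏₂-↭ h h-sym Perm.refl          = refl
∏₂-↭ h h-sym (prep x p)    = cong₂ _*_ (∏-↭ (h x) p) (∏₂-↭ h h-sym p)
∏₂-↭ h h-sym (swap {xs} {ys} x y p)  = begin
  (h x y * ∏ xs (h x)) * (∏ xs (h y) * ∏₂ xs h)  ≡⟨ interchange (h x y) (∏ xs (h x)) (∏ xs (h y)) (∏₂ xs h) ⟩
  (h x y * ∏ xs (h y)) * (∏ xs (h x) * ∏₂ xs h)
    ≡⟨ cong₂ _*_ (cong₂ _*_ (h-sym x y) (∏-↭ (h y) p)) (cong₂ _*_ (∏-↭ (h x) p) (∏₂-↭ h h-sym p)) ⟩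
  (h y x * ∏ ys (h y)) * (∏ ys (h x) * ∏₂ ys h) ∎
  where open ≡-Reasoning
∏₂-↭ h h-sym (Perm.trans p q) = trans (∏₂-↭ h h-sym p) (∏₂-↭ h h-sym q)

∏₂-++ : (xs ys : List X) (h : X → X → ℤ) →
  ∏₂ (xs ++ ys) h ≡ ∏₂ xs h * ∏₂ ys h * ∏ xs (λ x → ∏ ys (h x))
∏₂-++ []       ys h = sym (trans (ℤₚ.*-identityʳ _) (ℤₚ.*-identityˡ _))
∏₂-++ (x ∷ xs) ys h = trans (cong₂ _*_ (∏-++ xs ys (h x)) (∏₂-++ xs ys h))
  (lem (∏ xs (h x)) (∏ ys (h x)) (∏₂ xs h) (∏₂ ys h) _)
  where
  lem : ∀ a b c d e → (a * b) * (c * d * e) ≡ (a * c) * d * (b * e)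
  lem = solve-∀

∏-comm : (xs : List X) (ys : List Y) (f : X → Y → ℤ) →
  ∏ xs (λ x → ∏ ys (f x)) ≡ ∏ ys (λ y → ∏ xs (λ x → f x y))
∏-comm []       ys f = sym (∏-1 ys)
∏-comm (x ∷ xs) ys f = trans (cong (∏ ys (f x) *_) (∏-comm xs ys f)) (sym (∏-* ys (f x) _))

∏-cartesianProductWith : (g : X → Y → Z) (xs : List X) (ys : List Y) (f : Z → ℤ) →
  ∏ (cartesianProductWith g xs ys) f ≡ ∏ xs (λ x → ∏ ys (λ y → f (g x y)))
∏-cartesianProductWith g []       ys f = refl
∏-cartesianProductWith g (x ∷ xs) ys f = trans (∏-++ (map (g x) ys) _ f)
  (cong₂ _*_ (∏-map (g x) ys f) (∏-cartesianProductWith g xs ys f))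

-- Two cells lie in one block or in two different blocks. In the second case the positions inside
-- the blocks are unrelated, hence the full double product over `y` and `y′`.
∏₂-cartesianProductWith : (g : X → Y → Z) (xs : List X) (ys : List Y) (h : Z → Z → ℤ) →
  ∏₂ (cartesianProductWith g xs ys) h ≡
    ∏ xs (λ x → ∏₂ ys (λ y y′ → h (g x y) (g x y′))) *
    ∏₂ xs (λ x x′ → ∏ ys (λ y → ∏ ys (λ y′ → h (g x y) (g x′ y′))))
∏₂-cartesianProductWith g []       ys h = refl
∏₂-cartesianProductWith g (x ∷ xs) ys h = begin
  ∏₂ (map (g x) ys ++ R) h
    ≡⟨ ∏₂-++ (map (g x) ys) R h ⟩
  ∏₂ (map (g x) ys) h * ∏₂ R h * ∏ (map (g x) ys) (λ z → ∏ R (h z))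
    ≡⟨ cong₂ _*_ (cong₂ _*_ (∏₂-map (g x) ys h) (∏₂-cartesianProductWith g xs ys h))
         (trans (∏-map (g x) ys _)
         (trans (∏-cong ys (λ y → ∏-cartesianProductWith g xs ys (h (g x y))))
                (∏-comm ys xs _))) ⟩
  within * (withins * crosses) * cross
    ≡⟨ lem within withins crosses cross ⟩
  (within * withins) * (cross * crosses) ∎
  where
  open ≡-Reasoning
  R = cartesianProductWith g xs ys
  within  = ∏₂ ys (λ y y′ → h (g x y) (g x y′))
  withins = ∏ xs (λ x′ → ∏₂ ys (λ y y′ → h (g x′ y) (g x′ y′)))
  cross   = ∏ xs (λ x′ → ∏ ys (λ y → ∏ ys (λ y′ → h (g x y) (g x′ y′))))
  crosses = ∏₂ xs (λ x x′ → ∏ ys (λ y → ∏ ys (λ y′ → h (g x y) (g x′ y′))))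
  lem : ∀ a b c d → a * (b * c) * d ≡ (a * b) * (d * c)
  lem = solve-∀

-- Every ordered pair is matched with its reverse. This links inversions, which are counted over
-- ordered pairs, with products over unordered ones.
∏∏≡∏₂ : (xs : List X) (q : X → X → ℤ) → (∀ x → q x x ≡ 1ℤ) →
  ∏ xs (λ x → ∏ xs (q x)) ≡ ∏₂ xs (λ x y → q x y * q y x)
∏∏≡∏₂ []       q q1 = refl
∏∏≡∏₂ (x ∷ xs) q q1 = begin
  q x x * ∏ xs (q x) * ∏ xs (λ y → q y x * ∏ xs (q y))
    ≡⟨ cong₂ _*_ (trans (cong (_* ∏ xs (q x)) (q1 x)) (ℤₚ.*-identityˡ _))
         (trans (∏-* xs (λ y → q y x) _) (cong (∏ xs (λ y → q y x) *_) (∏∏≡∏₂ xs q q1))) ⟩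
  ∏ xs (q x) * (∏ xs (λ y → q y x) * ∏₂ xs (λ x y → q x y * q y x))
    ≡⟨ sym (ℤₚ.*-assoc (∏ xs (q x)) _ _) ⟩
  ∏ xs (q x) * ∏ xs (λ y → q y x) * ∏₂ xs (λ x y → q x y * q y x)
    ≡⟨ cong (_* ∏₂ xs (λ x y → q x y * q y x)) (sym (∏-* xs (q x) (λ y → q y x))) ⟩
  _ ∎
  where open ≡-Reasoning

-- The binomial coefficient n(n-1)/2, the number of factors of `∏₂` on a list of length n, with the
-- same recursion as `∏₂`.
triangular : ℕ → ℕ
triangular zero    = 0
triangular (suc n) = n ℕ.+ triangular n

∏-const : (c : ℤ) (xs : List X) → ∏ xs (λ _ → c) ≡ c ^ length xs
∏-const c []       = refl
∏-const c (x ∷ xs) = cong (c *_) (∏-const c xs)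

∏₂-const : (c : ℤ) (xs : List X) → ∏₂ xs (λ _ _ → c) ≡ c ^ triangular (length xs)
∏₂-const c []       = refl
∏₂-const c (x ∷ xs) = trans (cong₂ _*_ (∏-const c xs) (∏₂-const c xs))
  (sym (ℤₚ.^-distribˡ-+-* c (length xs) _))

-- Injective self-maps of Fin n

Inj : (X → Y) → Set
Inj f = ∀ x y → f x ≡ f y → x ≡ y

Inj-∘ : {f : Y → Z} {g : X → Y} → Inj f → Inj g → Inj (f ∘ g)
Inj-∘ f-inj g-inj x y = g-inj x y ∘ f-inj _ _

Inj-cong : {f g : X → Y} → (∀ x → f x ≡ g x) → Inj f → Inj g
Inj-cong f≗g f-inj x y eq = f-inj x y (trans (f≗g x) (trans eq (sym (f≗g y))))

-- Pigeonhole: if y were missed, punching y out of the codomain would inject `Fin (suc n)` into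
-- `Fin n`.
Inj⇒surjective : (f : Fin n → Fin n) → Inj f → ∀ y → ∃ λ x → f x ≡ y
Inj⇒surjective {suc n} f f-inj y with Finₚ.any? (λ x → f x Finₚ.≟ y)
... | yes found = found
... | no ∄x     = contradiction (Finₚ.injective⇒≤ {f = λ x → punchOut (y≢f x)}
                    (λ {x} {x′} eq → f-inj x x′ (Finₚ.punchOut-injective (y≢f x) (y≢f x′) eq)))
                    ℕₚ.1+n≰n
  where
  y≢f : ∀ x → y ≢ f x
  y≢f x eq = ∄x (x , sym eq)

-- The junk value y is taken only when f misses y.
inv : (Fin n → Fin n) → Fin n → Fin n
inv f y with Finₚ.any? (λ x → f x Finₚ.≟ y)
... | yes (x , _) = x
... | no _        = y

f∘inv : (f : Fin n → Fin n) → Inj f → ∀ y → f (inv f y) ≡ y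
f∘inv f f-inj y with Finₚ.any? (λ x → f x Finₚ.≟ y)
... | yes (x , fx≡y) = fx≡y
... | no ∄x          = contradiction (Inj⇒surjective f f-inj y) ∄x

inv∘f : (f : Fin n → Fin n) → Inj f → ∀ x → inv f (f x) ≡ x
inv∘f f f-inj x = f-inj _ x (f∘inv f f-inj (f x))

inv-Inj : (f : Fin n → Fin n) → Inj f → Inj (inv f)
inv-Inj f f-inj x y eq = trans (sym (f∘inv f f-inj x)) (trans (cong f eq) (f∘inv f f-inj y))

inv-unique : (f g : Fin n → Fin n) → Inj f → (∀ x → f (g x) ≡ x) → ∀ x → inv f x ≡ g x
inv-unique f g f-inj fg x = f-inj _ _ (trans (f∘inv f f-inj x) (sym (fg x)))

inv-cong : (f g : Fin n → Fin n) → Inj g → (∀ x → f x ≡ g x) → ∀ y → inv f y ≡ inv g y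
inv-cong f g g-inj f≗g = inv-unique f (inv g) (Inj-cong (λ x → sym (f≗g x)) g-inj)
  (λ x → trans (f≗g (inv g x)) (f∘inv g g-inj x))

map-allFin-↭ : (f : Fin n → Fin n) → Inj f → map f (allFin n) ↭ allFin n
map-allFin-↭ {n} f f-inj = enumerates⇒↭
  (map-enumerates f (inv f) _ _ (λ x _ → inv∘f f f-inj x) (λ y _ → f∘inv f f-inj y) (allFin-enumerates n))
  (allFin-enumerates n)

-- Integers equal to 1 or -1

Unit : ℤ → Set
Unit z = z ≡ 1ℤ ⊎ z ≡ -1ℤ

unit-* : ∀ {y z} → Unit y → Unit z → Unit (y * z)
unit-* (inj₁ refl) (inj₁ refl) = inj₁ refl
unit-* (inj₁ refl) (inj₂ refl) = inj₂ refl
unit-* (inj₂ refl) (inj₁ refl) = inj₂ refl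
unit-* (inj₂ refl) (inj₂ refl) = inj₁ refl

unit-² : ∀ {z} → Unit z → z * z ≡ 1ℤ
unit-² (inj₁ refl) = refl
unit-² (inj₂ refl) = refl

unit-^ : ∀ {z} → Unit z → ∀ k → Unit (z ^ k)
unit-^ u zero    = inj₁ refl
unit-^ u (suc k) = unit-* u (unit-^ u k)

unit-∏ : (xs : List X) {f : X → ℤ} → (∀ x → Unit (f x)) → Unit (∏ xs f)
unit-∏ []       u = inj₁ refl
unit-∏ (x ∷ xs) u = unit-* (u x) (unit-∏ xs u)

unit-∏₂ : {R : X → X → Set} {xs : List X} {h : X → X → ℤ} → AllPairs R xs →
          (∀ x y → R x y → Unit (h x y)) → Unit (∏₂ xs h)
unit-∏₂ []       u = inj₁ refl
unit-∏₂ {xs = x ∷ xs} {h} (p ∷ ps) u = unit-* (go p) (unit-∏₂ ps u)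
  where
  go : ∀ {ys} → All _ ys → Unit (∏ ys (h x))
  go []       = inj₁ refl
  go (q ∷ qs) = unit-* (u x _ q) (go qs)

1^ : ∀ k → 1ℤ ^ k ≡ 1ℤ
1^ zero    = refl
1^ (suc k) = trans (ℤₚ.*-identityˡ _) (1^ k)

-- k² and k have the same parity. No arithmetic on exponents is involved: if `-1ℤ ^ k` is 1, so is
-- its k-th power; if it is -1, its k-th power is `-1ℤ ^ k` again.
unit-^-idem : ∀ k → (-1ℤ ^ k) ^ k ≡ -1ℤ ^ k
unit-^-idem k with -1ℤ ^ k in eq | unit-^ (inj₂ refl) k
... | _ | inj₁ refl = 1^ k
... | _ | inj₂ refl = eq

-- Signs of permutations

-- The sign of b - a. The value 0 on the diagonal makes antisymmetry hold without side conditions.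
sgn : Fin n → Fin n → ℤ
sgn zero    zero    = 0ℤ
sgn zero    (suc b) = 1ℤ
sgn (suc a) zero    = -1ℤ
sgn (suc a) (suc b) = sgn a b

sgn-antisym : (a b : Fin n) → sgn b a ≡ - sgn a b
sgn-antisym zero    zero    = refl
sgn-antisym zero    (suc b) = refl
sgn-antisym (suc a) zero    = refl
sgn-antisym (suc a) (suc b) = sgn-antisym a b

sgn-unit : {a b : Fin n} → a ≢ b → Unit (sgn a b)
sgn-unit {a = zero}  {zero}  a≢b = ⊥-elim (a≢b refl)
sgn-unit {a = zero}  {suc b} a≢b = inj₁ refl
sgn-unit {a = suc a} {zero}  a≢b = inj₂ refl
sgn-unit {a = suc a} {suc b} a≢b = sgn-unit (a≢b ∘ cong suc)

sgn-<ᵇ : (a b : Fin n) →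
  (a ≡ b) ⊎
  (sgn a b ≡ 1ℤ × (toℕ a <ᵇ toℕ b) ≡ true × (toℕ b <ᵇ toℕ a) ≡ false) ⊎
  (sgn a b ≡ -1ℤ × (toℕ a <ᵇ toℕ b) ≡ false × (toℕ b <ᵇ toℕ a) ≡ true)
sgn-<ᵇ zero    zero    = inj₁ refl
sgn-<ᵇ zero    (suc b) = inj₂ (inj₁ (refl , refl , refl))
sgn-<ᵇ (suc a) zero    = inj₂ (inj₂ (refl , refl , refl))
sgn-<ᵇ (suc a) (suc b) with sgn-<ᵇ a b
... | inj₁ eq = inj₁ (cong suc eq)
... | inj₂ r  = inj₂ r

-- Both factors are antisymmetric, so the product over unordered pairs is well defined.
ε : (Fin n → Fin n) → ℤ
ε {n} f = ∏₂ (allFin n) (λ a b → sgn a b * sgn (f a) (f b))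

private
  neg*neg : ∀ a b → - a * - b ≡ a * b
  neg*neg = solve-∀

antisym-*-sym : {s t : X → X → ℤ} → (∀ x y → s y x ≡ - s x y) → (∀ x y → t y x ≡ - t x y) →
                ∀ x y → s x y * t x y ≡ s y x * t y x
antisym-*-sym {s = s} {t} s-anti t-anti x y =
  sym (trans (cong₂ _*_ (s-anti x y) (t-anti x y)) (neg*neg (s x y) (t x y)))

Inj-≢ : {f : X → Y} → Inj f → ∀ {x y} → x ≢ y → f x ≢ f y
Inj-≢ f-inj x≢y eq = x≢y (f-inj _ _ eq)

ε-cong : {f g : Fin n → Fin n} → (∀ x → f x ≡ g x) → ε f ≡ ε g
ε-cong {n} f≗g = ∏₂-cong′ (allFin n) (λ a b → cong₂ (λ u v → sgn a b * sgn u v) (f≗g a) (f≗g b))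

ε-unit : {f : Fin n → Fin n} → Inj f → Unit (ε f)
ε-unit {n} f-inj = unit-∏₂ (Unique.allFin⁺ n) (λ a b a≢b → unit-* (sgn-unit a≢b) (sgn-unit (Inj-≢ f-inj a≢b)))

ε-id : ε {n} id ≡ 1ℤ
ε-id {n} = trans (∏₂-cong (Unique.allFin⁺ n) (λ a b a≢b → unit-² (sgn-unit a≢b))) (∏₂-1 (allFin n))

-- Inserting the square of `sgn (g a) (g b)` splits each factor into a factor of `ε f` at the pair
-- (g a, g b) and a factor of `ε g` at (a, b); since g permutes the unordered pairs, the first kind
-- multiplies to `ε f`.
ε-∘ : (f g : Fin n → Fin n) → Inj g → ε (f ∘ g) ≡ ε f * ε g
ε-∘ {n} f g g-inj = begin
  ε (f ∘ g)
    ≡⟨ ∏₂-cong (Unique.allFin⁺ n) (λ a b a≢b →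
         split (sgn a b) (sgn (f (g a)) (f (g b))) (sgn-unit (Inj-≢ g-inj a≢b))) ⟩
  ∏₂ (allFin n) (λ a b → h (g a) (g b) * (sgn a b * sgn (g a) (g b)))
    ≡⟨ ∏₂-* (allFin n) (λ a b → h (g a) (g b)) (λ a b → sgn a b * sgn (g a) (g b)) ⟩
  ∏₂ (allFin n) (λ a b → h (g a) (g b)) * ε g
    ≡⟨ cong (_* ε g) (sym (∏₂-map g (allFin n) h)) ⟩
  ∏₂ (map g (allFin n)) h * ε g
    ≡⟨ cong (_* ε g) (∏₂-↭ h (antisym-*-sym {s = sgn} {λ a b → sgn (f a) (f b)} sgn-antisym (λ a b → sgn-antisym (f a) (f b)))
         (map-allFin-↭ g g-inj)) ⟩
  ε f * ε g ∎
  where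
  open ≡-Reasoning
  h : Fin n → Fin n → ℤ
  h a b = sgn a b * sgn (f a) (f b)
  split : ∀ x z {y} → Unit y → x * z ≡ (y * z) * (x * y)
  split x z {y} u = trans (sym (ℤₚ.*-identityˡ _)) (trans (cong (_* (x * z)) (sym (unit-² u))) (lem x y z))
    where
    lem : ∀ x y z → y * y * (x * z) ≡ (y * z) * (x * y)
    lem = solve-∀

ε-inverse : (f g : Fin n → Fin n) → Inj f → Inj g → (∀ x → f (g x) ≡ x) → ε f ≡ ε g
ε-inverse {n} f g f-inj g-inj fg = begin
  ε f               ≡⟨ sym (ℤₚ.*-identityʳ _) ⟩
  ε f * 1ℤ          ≡⟨ cong (ε f *_) (sym (unit-² (ε-unit g-inj))) ⟩
  ε f * (ε g * ε g) ≡⟨ sym (ℤₚ.*-assoc (ε f) (ε g) (ε g)) ⟩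
  ε f * ε g * ε g   ≡⟨ cong (_* ε g) (trans (sym (ε-∘ f g g-inj)) (trans (ε-cong fg) (ε-id {n}))) ⟩
  1ℤ * ε g          ≡⟨ ℤₚ.*-identityˡ _ ⟩
  ε g               ∎
  where open ≡-Reasoning

-1^length-select : (p : X → Bool) (xs : List X) →
  -1ℤ ^ length (select p xs) ≡ ∏ xs (λ x → if p x then -1ℤ else 1ℤ)
-1^length-select p []       = refl
-1^length-select p (x ∷ xs) with p x
... | true  = cong (-1ℤ *_) (-1^length-select p xs)
... | false = trans (-1^length-select p xs) (sym (ℤₚ.*-identityˡ _))

-1^length-concatMap : (f : X → List Y) (xs : List X) →
  -1ℤ ^ length (concatMap f xs) ≡ ∏ xs (λ x → -1ℤ ^ length (f x))
-1^length-concatMap f []       = refl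
-1^length-concatMap f (x ∷ xs) = trans (cong (-1ℤ ^_) (Listₚ.length-++ (f x)))
  (trans (ℤₚ.^-distribˡ-+-* -1ℤ (length (f x)) _) (cong (-1ℤ ^ length (f x) *_) (-1^length-concatMap f xs)))

-- Of the two orders of a pair only the increasing one can count as an inversion, and it does so
-- exactly when π reverses the pair, which is when the two comparisons in `ε` disagree.
sign≡ε : (π : Perm n) → Inj (lookup π) → sign π ≡ ε (lookup π)
sign≡ε {n} π π-inj = begin
  sign π
    ≡⟨ trans (-1^length-concatMap _ (allFin n)) (∏-cong (allFin n) (λ a → -1^length-select _ (allFin n))) ⟩
  ∏ (allFin n) (λ a → ∏ (allFin n) (q a))
    ≡⟨ ∏∏≡∏₂ (allFin n) q q-diag ⟩
  ∏₂ (allFin n) (λ a b → q a b * q b a)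
    ≡⟨ ∏₂-cong (Unique.allFin⁺ n) q-sgn ⟩
  ε (lookup π) ∎
  where
  open ≡-Reasoning
  q : Fin n → Fin n → ℤ
  q a b = if (toℕ a <ᵇ toℕ b) ∧ (toℕ (lookup π b) <ᵇ toℕ (lookup π a)) then -1ℤ else 1ℤ
  <ᵇ-irrefl : ∀ k → (k <ᵇ k) ≡ false
  <ᵇ-irrefl zero    = refl
  <ᵇ-irrefl (suc k) = <ᵇ-irrefl k
  q-diag : ∀ a → q a a ≡ 1ℤ
  q-diag a rewrite <ᵇ-irrefl (toℕ a) = refl
  q-sgn : ∀ a b → a ≢ b → q a b * q b a ≡ sgn a b * sgn (lookup π a) (lookup π b)
  q-sgn a b a≢b with sgn-<ᵇ a b | sgn-<ᵇ (lookup π a) (lookup π b)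
  ... | inj₁ a≡b | _ = contradiction a≡b a≢b
  ... | inj₂ _ | inj₁ eq = contradiction (π-inj a b eq) a≢b
  ... | inj₂ (inj₁ (e , f , g)) | inj₂ (inj₁ (e′ , _ , g′)) rewrite e | f | g | e′ | g′ = refl
  ... | inj₂ (inj₁ (e , f , g)) | inj₂ (inj₂ (e′ , _ , g′)) rewrite e | f | g | e′ | g′ = refl
  ... | inj₂ (inj₂ (e , f , g)) | inj₂ (inj₁ (e′ , f′ , _)) rewrite e | f | g | e′ | f′ = refl
  ... | inj₂ (inj₂ (e , f , g)) | inj₂ (inj₂ (e′ , f′ , _)) rewrite e | f | g | e′ | f′ = refl

-- Transpositions

transposition : Fin n → Fin n → Fin n → Fin n
transposition a b x with x Finₚ.≟ a | x Finₚ.≟ b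
... | yes _ | _     = b
... | no _  | yes _ = a
... | no _  | no _  = x

transposition-left : (a b : Fin n) → transposition a b a ≡ b
transposition-left a b with a Finₚ.≟ a | a Finₚ.≟ b
... | yes _ | _ = refl
... | no a≢a | _ = contradiction refl a≢a

transposition-right : (a b : Fin n) → transposition a b b ≡ a
transposition-right a b with b Finₚ.≟ a | b Finₚ.≟ b
... | yes b≡a | _ = b≡a
... | no _ | yes _ = refl
... | no _ | no b≢b = contradiction refl b≢b

transposition-other : (a b : Fin n) {x : Fin n} → x ≢ a → x ≢ b → transposition a b x ≡ x
transposition-other a b {x} x≢a x≢b with x Finₚ.≟ a | x Finₚ.≟ b
... | yes x≡a | _ = contradiction x≡a x≢a
... | no _ | yes x≡b = contradiction x≡b x≢b
... | no _ | no _ = refl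

transposition-involutive : (a b x : Fin n) → transposition a b (transposition a b x) ≡ x
transposition-involutive a b x with x Finₚ.≟ a | x Finₚ.≟ b
... | yes refl | _        = transposition-right a b
... | no _     | yes refl = transposition-left a b
... | no x≢a   | no x≢b   = transposition-other a b x≢a x≢b

involutive⇒Inj : {f : X → X} → (∀ x → f (f x) ≡ x) → Inj f
involutive⇒Inj {f = f} ff x y eq = trans (sym (ff x)) (trans (cong f eq) (ff y))

-- Enumerating a and b first, only the pair (a , b) contributes: every other c meets a and b in
-- two pairs whose contributions cancel.
ε-transposition : {a b : Fin n} → a ≢ b → ε (transposition a b) ≡ -1ℤ
ε-transposition {n} {a} {b} a≢b = begin
  ε t                    ≡⟨ ∏₂-↭ h (antisym-*-sym {s = sgn} {λ x y → sgn (t x) (t y)} sgn-antisym (λ x y → sgn-antisym (t x) (t y)))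
                              (enumerates⇒↭ (allFin-enumerates n) list-enumerates) ⟩
  ∏₂ (a ∷ b ∷ rest) h    ≡⟨⟩
  h a b * ∏ rest (h a) * (∏ rest (h b) * ∏₂ rest h)
                         ≡⟨ lem (h a b) (∏ rest (h a)) (∏ rest (h b)) (∏₂ rest h) ⟩
  h a b * (∏ rest (h a) * ∏ rest (h b) * ∏₂ rest h)
                         ≡⟨ cong₂ (λ x y → h a b * (x * y)) (trans (sym (∏-* rest (h a) (h b))) (cancel rest rest-others)) others ⟩
  h a b * (1ℤ * 1ℤ)      ≡⟨ ℤₚ.*-identityʳ _ ⟩
  sgn a b * sgn (t a) (t b)
                         ≡⟨ cong₂ (λ x y → sgn a b * sgn x y) (transposition-left a b) (transposition-right a b) ⟩
  sgn a b * sgn b a      ≡⟨ sgn-flip a≢b ⟩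
  -1ℤ                    ∎
  where
  open ≡-Reasoning
  t = transposition a b
  h : Fin n → Fin n → ℤ
  h x y = sgn x y * sgn (t x) (t y)
  Other : Fin n → Set
  Other x = x ≢ a × x ≢ b
  other? : Fin n → Bool
  other? x = not (does (x Finₚ.≟ a)) ∧ not (does (x Finₚ.≟ b))
  other?⇔Other : ∀ x → other? x ≡ true ⇔ Other x
  other?⇔Other x with x Finₚ.≟ a | x Finₚ.≟ b
  ... | yes x≡a | _       = mk⇔ (λ ()) (λ (x≢a , _) → contradiction x≡a x≢a)
  ... | no _    | yes x≡b = mk⇔ (λ ()) (λ (_ , x≢b) → contradiction x≡b x≢b)
  ... | no x≢a  | no x≢b  = mk⇔ (λ _ → x≢a , x≢b) (λ _ → refl)
  rest = select other? (allFin n)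
  rest-enumerates : rest enumerates (λ x → ⊤ × Other x)
  rest-enumerates = select-enumerates other?⇔Other (allFin-enumerates n)
  list-enumerates : a ∷ b ∷ rest enumerates (λ _ → ⊤)
  list-enumerates = enumeration
    ((a≢b ∷ All.tabulate (λ x∈ eq → proj₁ (proj₂ (sound rest-enumerates x∈)) (sym eq)))
      ∷ All.tabulate (λ x∈ eq → proj₂ (proj₂ (sound rest-enumerates x∈)) (sym eq)) ∷ unique rest-enumerates)
    _ (λ {x} _ → mem x)
    where
    mem : ∀ x → x ∈ a ∷ b ∷ rest
    mem x with x Finₚ.≟ a | x Finₚ.≟ b
    ... | yes x≡a | _       = here x≡a
    ... | no _    | yes x≡b = there (here x≡b)
    ... | no x≢a  | no x≢b  = there (there (complete rest-enumerates (_ , x≢a , x≢b)))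
  rest-others : ∀ {x} → x ∈ rest → Other x
  rest-others x∈ = proj₂ (sound rest-enumerates x∈)
  lem : ∀ p q r s → p * q * (r * s) ≡ p * (q * r * s)
  lem = solve-∀
  square : ∀ x y → x * y * (y * x) ≡ (x * y) * (x * y)
  square = solve-∀
  sgn-flip : ∀ {x y : Fin n} → x ≢ y → sgn x y * sgn y x ≡ -1ℤ
  sgn-flip {x} {y} x≢y = trans (cong (sgn x y *_) (sgn-antisym x y))
    (trans (sym (ℤₚ.neg-distribʳ-* (sgn x y) (sgn x y))) (cong -_ (unit-² (sgn-unit x≢y))))
  cancel : ∀ xs → (∀ {x} → x ∈ xs → Other x) → ∏ xs (λ x → h a x * h b x) ≡ 1ℤ
  cancel []       _ = refl
  cancel (x ∷ xs) o = trans (cong₂ _*_ here-1 (cancel xs (o ∘ there))) refl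
    where
    x≢a = proj₁ (o (here refl))
    x≢b = proj₂ (o (here refl))
    here-1 : h a x * h b x ≡ 1ℤ
    here-1 = trans (cong₂ _*_ (cong₂ (λ u v → sgn a x * sgn u v) (transposition-left a b) (transposition-other a b x≢a x≢b))
                              (cong₂ (λ u v → sgn b x * sgn u v) (transposition-right a b) (transposition-other a b x≢a x≢b)))
             (trans (square (sgn a x) (sgn b x)) (unit-² (unit-* (sgn-unit (x≢a ∘ sym)) (sgn-unit (x≢b ∘ sym)))))
  others : ∏₂ rest h ≡ 1ℤ
  others = go rest rest-others (unique rest-enumerates)
    where
    go : ∀ xs → (∀ {x} → x ∈ xs → Other x) → Unique xs → ∏₂ xs h ≡ 1ℤ
    go []       o _       = refl
    go (x ∷ xs) o (p ∷ u) = cong₂ _*_ (inner xs (o ∘ there) p) (go xs (o ∘ there) u)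
      where
      inner : ∀ ys → (∀ {y} → y ∈ ys → Other y) → All (x ≢_) ys → ∏ ys (h x) ≡ 1ℤ
      inner []       o′ _       = refl
      inner (y ∷ ys) o′ (q ∷ qs) = cong₂ _*_
        (trans (cong₂ (λ u v → sgn x y * sgn u v)
                 (transposition-other a b (proj₁ (o (here refl))) (proj₂ (o (here refl))))
                 (transposition-other a b (proj₁ (o′ (here refl))) (proj₂ (o′ (here refl)))))
               (unit-² (sgn-unit q)))
        (inner ys (o′ ∘ there) qs)

-- The three signs of a Latin square

-- Compares (a, b) with (a′, b′) lexicographically; the arguments are grouped by coordinate and not
-- by pair.
lex : Fin n → Fin n → Fin n → Fin n → ℤ
lex a a′ b b′ with a Finₚ.≟ a′
... | yes _ = sgn b b′
... | no _  = sgn a a′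

lex-≡ : (a b b′ : Fin n) → lex a a b b′ ≡ sgn b b′
lex-≡ a b b′ with a Finₚ.≟ a
... | yes _  = refl
... | no a≢a = contradiction refl a≢a

lex-≢ : {a a′ : Fin n} → a ≢ a′ → (b b′ : Fin n) → lex a a′ b b′ ≡ sgn a a′
lex-≢ {a = a} {a′} a≢a′ b b′ with a Finₚ.≟ a′
... | yes a≡a′ = contradiction a≡a′ a≢a′
... | no _     = refl

lex-antisym : (a a′ b b′ : Fin n) → lex a′ a b′ b ≡ - lex a a′ b b′
lex-antisym a a′ b b′ with a Finₚ.≟ a′
... | yes refl = trans (lex-≡ a b′ b) (sgn-antisym b b′)
... | no a≢a′  = trans (lex-≢ (a≢a′ ∘ sym) b′ b) (sgn-antisym a a′)

lexOn : (X → Fin n) → (X → Fin n) → X → X → ℤ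
lexOn x y p q = lex (x p) (x q) (y p) (y q)

lexOn-*-sym : (x y x′ y′ : X → Fin n) → ∀ p q →
  lexOn x y p q * lexOn x′ y′ p q ≡ lexOn x y q p * lexOn x′ y′ q p
lexOn-*-sym x y x′ y′ = antisym-*-sym {s = lexOn x y} {lexOn x′ y′}
  (λ p q → lex-antisym (x p) (x q) (y p) (y q)) (λ p q → lex-antisym (x′ p) (x′ q) (y′ p) (y′ q))

-- Two cells with different x contribute sgn² = 1, so only the pairs inside a block survive.
∏ε≡∏₂lex : (g : Fin n → Fin n → X) (x y z : X → Fin n) →
  (∀ a b → x (g a b) ≡ a) → (∀ a b → y (g a b) ≡ b) →
  ∏ (allFin n) (λ a → ε (λ b → z (g a b))) ≡
  ∏₂ (cartesianProductWith g (allFin n) (allFin n)) (λ p q → lexOn x y p q * lexOn x z p q)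
∏ε≡∏₂lex {n} g x y z xg yg = sym (begin
  ∏₂ (cartesianProductWith g (allFin n) (allFin n)) h
    ≡⟨ ∏₂-cartesianProductWith g (allFin n) (allFin n) h ⟩
  ∏ (allFin n) (λ a → ∏₂ (allFin n) (λ b b′ → h (g a b) (g a b′))) *
  ∏₂ (allFin n) (λ a a′ → ∏ (allFin n) (λ b → ∏ (allFin n) (λ b′ → h (g a b) (g a′ b′))))
    ≡⟨ cong₂ _*_ (∏-cong (allFin n) (λ a → ∏₂-cong′ (allFin n) (within a)))
         (trans (∏₂-cong (Unique.allFin⁺ n) (λ a a′ a≢a′ →
                   trans (∏-cong (allFin n) (λ b → trans (∏-cong (allFin n) (across a≢a′ b)) (∏-1 (allFin n))))
                         (∏-1 (allFin n))))
                (∏₂-1 (allFin n))) ⟩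
  ∏ (allFin n) (λ a → ε (λ b → z (g a b))) * 1ℤ
    ≡⟨ ℤₚ.*-identityʳ _ ⟩
  ∏ (allFin n) (λ a → ε (λ b → z (g a b))) ∎)
  where
  open ≡-Reasoning
  h = λ p q → lexOn x y p q * lexOn x z p q
  within : ∀ a b b′ → h (g a b) (g a b′) ≡ sgn b b′ * sgn (z (g a b)) (z (g a b′))
  within a b b′ rewrite xg a b | xg a b′ | yg a b | yg a b′ =
    cong₂ _*_ (lex-≡ a b b′) (lex-≡ a (z (g a b)) (z (g a b′)))
  across : ∀ {a a′} → a ≢ a′ → ∀ b b′ → h (g a b) (g a′ b′) ≡ 1ℤ
  across {a} {a′} a≢a′ b b′ rewrite xg a b | xg a′ b′ =
    trans (cong₂ _*_ (lex-≢ a≢a′ (y (g a b)) (y (g a′ b′))) (lex-≢ a≢a′ (z (g a b)) (z (g a′ b′))))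
          (unit-² (sgn-unit a≢a′))

grid : ∀ n → List (Fin n × Fin n)
grid n = cartesianProduct (allFin n) (allFin n)

grid-enumerates : ∀ n → grid n enumerates (λ _ → ⊤)
grid-enumerates n = enumerates-⇔ (λ _ → mk⇔ _ _)
  (cartesianProduct-enumerates (allFin-enumerates n) (allFin-enumerates n))

map-grid-↭ : (φ ψ : Fin n × Fin n → Fin n × Fin n) → (∀ p → ψ (φ p) ≡ p) → (∀ p → φ (ψ p) ≡ p) →
  map φ (grid n) ↭ grid n
map-grid-↭ {n} φ ψ ψφ φψ = enumerates⇒↭
  (map-enumerates φ ψ _ _ (λ p _ → ψφ p) (λ p _ → φψ p) (grid-enumerates n)) (grid-enumerates n)

-- The number of pairs of cells on which the two lexicographic orders of the grid disagree is
-- the square of triangular n.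
∏₂-lex-swap : ∀ n →
  ∏₂ (grid n) (λ p q → lexOn proj₁ proj₂ p q * lexOn proj₂ proj₁ p q) ≡ -1ℤ ^ triangular n
∏₂-lex-swap n = begin
  ∏₂ (grid n) h
    ≡⟨ ∏₂-cartesianProductWith _,_ (allFin n) (allFin n) h ⟩
  ∏ (allFin n) (λ a → ∏₂ (allFin n) (λ b b′ → h (a , b) (a , b′))) *
  ∏₂ (allFin n) (λ a a′ → ∏ (allFin n) (λ b → ∏ (allFin n) (λ b′ → h (a , b) (a′ , b′))))
    ≡⟨ cong₂ _*_
         (trans (∏-cong (allFin n) (λ a → trans (∏₂-cong (Unique.allFin⁺ n) (within a)) (∏₂-1 (allFin n)))) (∏-1 (allFin n)))
         (trans (∏₂-cong (Unique.allFin⁺ n) (λ a a′ a≢a′ → across a≢a′)) (∏₂-const κ (allFin n))) ⟩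
  1ℤ * κ ^ triangular (length (allFin n))
    ≡⟨ trans (ℤₚ.*-identityˡ _) (cong (λ k → κ ^ triangular k) (Listₚ.length-tabulate {n = n} id)) ⟩
  κ ^ triangular n
    ≡⟨ unit-^-idem (triangular n) ⟩
  κ ∎
  where
  open ≡-Reasoning
  κ = -1ℤ ^ triangular n
  h : Fin n × Fin n → Fin n × Fin n → ℤ
  h p q = lexOn proj₁ proj₂ p q * lexOn proj₂ proj₁ p q
  within : ∀ a b b′ → b ≢ b′ → h (a , b) (a , b′) ≡ 1ℤ
  within a b b′ b≢b′ = trans (cong₂ _*_ (lex-≡ a b b′) (lex-≢ b≢b′ a a)) (unit-² (sgn-unit b≢b′))
  diag : ∀ {a a′} → a ≢ a′ → ∀ b → h (a , b) (a′ , b) ≡ 1ℤ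
  diag {a} {a′} a≢a′ b = trans (cong₂ _*_ (lex-≢ a≢a′ b b) (lex-≡ b a a′)) (unit-² (sgn-unit a≢a′))
  lem : ∀ s t → (s * t) * (s * - t) ≡ - ((s * t) * (s * t))
  lem = solve-∀
  -- Two rows and two columns span a rectangle with two diagonals. The two lexicographic orders
  -- agree on one diagonal and disagree on the other, so the rectangle contributes -1.
  offdiag : ∀ {a a′} → a ≢ a′ → ∀ b b′ → b ≢ b′ → h (a , b) (a′ , b′) * h (a , b′) (a′ , b) ≡ -1ℤ
  offdiag {a} {a′} a≢a′ b b′ b≢b′ = begin
    h (a , b) (a′ , b′) * h (a , b′) (a′ , b)
      ≡⟨ cong₂ _*_ (cong₂ _*_ (lex-≢ a≢a′ b b′) (lex-≢ b≢b′ a a′))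
                   (cong₂ _*_ (lex-≢ a≢a′ b′ b) (trans (lex-≢ (b≢b′ ∘ sym) a a′) (sgn-antisym b b′))) ⟩
    (sgn a a′ * sgn b b′) * (sgn a a′ * - sgn b b′)
      ≡⟨ lem (sgn a a′) (sgn b b′) ⟩
    - ((sgn a a′ * sgn b b′) * (sgn a a′ * sgn b b′))
      ≡⟨ cong -_ (unit-² (unit-* (sgn-unit a≢a′) (sgn-unit b≢b′))) ⟩
    -1ℤ ∎
  across : ∀ {a a′} → a ≢ a′ → ∏ (allFin n) (λ b → ∏ (allFin n) (λ b′ → h (a , b) (a′ , b′))) ≡ κ
  across {a} {a′} a≢a′ = begin
    ∏ (allFin n) (λ b → ∏ (allFin n) (λ b′ → h (a , b) (a′ , b′)))
      ≡⟨ ∏∏≡∏₂ (allFin n) (λ b b′ → h (a , b) (a′ , b′)) (diag a≢a′) ⟩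
    ∏₂ (allFin n) (λ b b′ → h (a , b) (a′ , b′) * h (a , b′) (a′ , b))
      ≡⟨ ∏₂-cong (Unique.allFin⁺ n) (offdiag a≢a′) ⟩
    ∏₂ (allFin n) (λ _ _ → -1ℤ)
      ≡⟨ trans (∏₂-const -1ℤ (allFin n)) (cong (λ k → -1ℤ ^ triangular k) (Listₚ.length-tabulate {n = n} id)) ⟩
    κ ∎

rowsSign colsSign : (Fin n → Fin n → Fin n) → ℤ
rowsSign {n} L = ∏ (allFin n) (λ i → ε (L i))
colsSign {n} L = ∏ (allFin n) (λ j → ε (λ i → L i j))

-- U s c = r means L r c = s, so the rows of U are the symbol permutations of L. Each sign
-- compares two lexicographic orders of the cells; multiplying the three comparisons and
-- regrouping the six orders leaves three copies of ∏₂-lex-swap.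
rows*cols*symbols : (L U V : Fin n → Fin n → Fin n) →
  (∀ r c → U (L r c) c ≡ r) → (∀ s c → L (U s c) c ≡ s) →
  (∀ r c → V r (L r c) ≡ c) → (∀ r s → L r (V r s) ≡ s) →
  rowsSign L * colsSign L * rowsSign U ≡ -1ℤ ^ triangular n
rows*cols*symbols {n} L U V UL LU VL LV = begin
  rowsSign L * colsSign L * rowsSign U
    ≡⟨ cong₂ _*_ (cong₂ _*_
         (∏ε≡∏₂lex _,_ r c s (λ _ _ → refl) (λ _ _ → refl))
         (block (λ c r → r , c) (λ (c , r) → r , c) (λ _ → refl) (λ _ → refl) c r s (λ _ _ → refl) (λ _ _ → refl)))
         (block (λ s c → U s c , c) (λ (r , c) → L r c , c) (λ (s , c) → cong (_, c) (LU s c)) (λ (r , c) → cong (_, c) (UL r c))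
           s c r LU (λ _ _ → refl)) ⟩
  Π r c r s * Π c r c s * Π s c s r
    ≡⟨ cong₂ _*_ (merge r c r s c r c s) refl ⟩
  ∏₂ G (λ p q → (l r c p q * l r s p q) * (l c r p q * l c s p q)) * Π s c s r
    ≡⟨ sym (∏₂-* G _ _) ⟩
  ∏₂ G (λ p q → (l r c p q * l r s p q) * (l c r p q * l c s p q) * (l s c p q * l s r p q))
    ≡⟨ ∏₂-cong′ G (λ p q → regroup (l r c p q) (l r s p q) (l c r p q) (l c s p q) (l s c p q) (l s r p q)) ⟩
  ∏₂ G (λ p q → (l r c p q * l c r p q) * (l r s p q * l s r p q) * (l s c p q * l c s p q))
    ≡⟨ ∏₂-* G _ _ ⟩
  ∏₂ G (λ p q → (l r c p q * l c r p q) * (l r s p q * l s r p q)) * Π s c c s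
    ≡⟨ cong (_* Π s c c s) (sym (merge r c c r r s s r)) ⟩
  Π r c c r * Π r s s r * Π s c c s
    ≡⟨ cong₂ _*_ (cong₂ _*_ (full r c id (λ _ → refl) (λ _ → refl))
         (full r s (λ (r , s) → r , V r s) (λ (r , c) → cong (r ,_) (VL r c)) (λ (r , s) → cong (r ,_) (LV r s))))
         (full s c (λ (s , c) → U s c , c) (λ (r , c) → cong (_, c) (UL r c)) (λ (s , c) → cong (_, c) (LU s c))) ⟩
  κ * κ * κ
    ≡⟨ trans (cong (_* κ) (unit-² (unit-^ (inj₂ refl) (triangular n)))) (ℤₚ.*-identityˡ κ) ⟩
  κ ∎
  where
  open ≡-Reasoning
  κ = -1ℤ ^ triangular n
  G = grid n
  r c s : Fin n × Fin n → Fin n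
  r = proj₁
  c = proj₂
  s p = L (r p) (c p)
  l = lexOn {Fin n × Fin n} {n}
  Π : (x y x′ y′ : Fin n × Fin n → Fin n) → ℤ
  Π x y x′ y′ = ∏₂ G (λ p q → l x y p q * l x′ y′ p q)
  merge : ∀ x y x′ y′ z w z′ w′ → Π x y x′ y′ * Π z w z′ w′ ≡
    ∏₂ G (λ p q → (l x y p q * l x′ y′ p q) * (l z w p q * l z′ w′ p q))
  merge x y x′ y′ z w z′ w′ = sym (∏₂-* G _ _)
  regroup : ∀ a b c d e f → (a * b) * (c * d) * (e * f) ≡ (a * c) * (b * f) * (e * d)
  regroup = solve-∀
  block : (g : Fin n → Fin n → Fin n × Fin n) (ψ : Fin n × Fin n → Fin n × Fin n) →
    (∀ p → ψ (uncurry g p) ≡ p) → (∀ p → uncurry g (ψ p) ≡ p) →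
    ∀ x y z → (∀ a b → x (g a b) ≡ a) → (∀ a b → y (g a b) ≡ b) →
    ∏ (allFin n) (λ a → ε (λ b → z (g a b))) ≡ Π x y x z
  block g ψ ψg gψ x y z xg yg = trans (∏ε≡∏₂lex g x y z xg yg)
    (∏₂-↭ _ (lexOn-*-sym x y x z)
      (↭-trans (↭-reflexive (sym (map-cartesianProductWith (uncurry g) _,_ (allFin n) (allFin n))))
               (map-grid-↭ (uncurry g) ψ ψg gψ)))
  -- Any two of row, column and symbol are coordinates on the cells; passing to these coordinates
  -- reduces the comparison of their two orders to the one for rows and columns.
  full : (x y : Fin n × Fin n → Fin n) (ψ : Fin n × Fin n → Fin n × Fin n) →
    (∀ p → ψ (x p , y p) ≡ p) → (∀ p → (x (ψ p) , y (ψ p)) ≡ p) → Π x y y x ≡ κ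
  full x y ψ ψφ φψ = begin
    Π x y y x                             ≡⟨ sym (∏₂-map (λ p → x p , y p) G h) ⟩
    ∏₂ (map (λ p → x p , y p) G) h        ≡⟨ ∏₂-↭ h (lexOn-*-sym r c c r) (map-grid-↭ (λ p → x p , y p) ψ ψφ φψ) ⟩
    ∏₂ G h                                ≡⟨ ∏₂-lex-swap n ⟩
    κ                                     ∎
    where
    h : Fin n × Fin n → Fin n × Fin n → ℤ
    h p q = l r c p q * l c r p q

-- Boolean tests as propositions

allL-⇔ : {p : Fin n → Bool} {P : Fin n → Set} → (∀ i → p i ≡ true ⇔ P i) →
  allL (allFin n) p ≡ true ⇔ (∀ i → P i)
allL-⇔ {n} {p} {P} p⇔P = mk⇔
  (λ eq i → to (p⇔P i) (elim (allFin n) eq (∈-allFin i)))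
  (λ Ps → intro (allFin n) (λ i → from (p⇔P i) (Ps i)))
  where
  elim : ∀ xs → allL xs p ≡ true → ∀ {i} → i ∈ xs → p i ≡ true
  elim (x ∷ xs) eq i∈ with p x in px
  elim (x ∷ xs) eq (here refl) | true = px
  elim (x ∷ xs) eq (there i∈)  | true = elim xs eq i∈
  intro : ∀ xs → (∀ i → p i ≡ true) → allL xs p ≡ true
  intro []       _  = refl
  intro (x ∷ xs) ps rewrite ps x = intro xs ps

==-⇔ : (a b : Fin n) → (a == b) ≡ true ⇔ a ≡ b
==-⇔ a b = mk⇔ (λ eq → Finₚ.toℕ-injective (ℕₚ.≡ᵇ⇒≡ _ _ (from T-≡ eq)))
               (λ { refl → to T-≡ (ℕₚ.≡⇒≡ᵇ (toℕ a) _ refl) })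

∧-⇔ : {a b : Bool} {P Q : Set} → a ≡ true ⇔ P → b ≡ true ⇔ Q → (a ∧ b) ≡ true ⇔ (P × Q)
∧-⇔ {true}  {b} a⇔P b⇔Q = mk⇔ (λ eq → to a⇔P refl , to b⇔Q eq) (λ (_ , q) → from b⇔Q q)
∧-⇔ {false} {b} a⇔P b⇔Q = mk⇔ (λ ()) (λ (p , _) → from a⇔P p)

injectiveᵇ-⇔ : (π : Perm n) → injectiveᵇ π ≡ true ⇔ Inj (lookup π)
injectiveᵇ-⇔ π = allL-⇔ (λ i → allL-⇔ (λ j → test i j))
  where
  test : ∀ i j → ((i == j) ∨ not (lookup π i == lookup π j)) ≡ true ⇔ (lookup π i ≡ lookup π j → i ≡ j)
  test i j with i == j in p | lookup π i == lookup π j in q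
  ... | true  | _     = mk⇔ (λ _ _ → to (==-⇔ i j) p) (λ _ → refl)
  ... | false | false = mk⇔ (λ _ eq → contradiction (trans (sym q) (from (==-⇔ _ _) eq)) λ ()) (λ _ → refl)
  ... | false | true  = mk⇔ (λ ()) (λ inj → trans (sym p) (from (==-⇔ i j) (inj (to (==-⇔ _ _) q))))

samePerm-idPerm-⇔ : (π : Perm n) → samePerm π (idPerm n) ≡ true ⇔ (∀ i → lookup π i ≡ i)
samePerm-idPerm-⇔ π = allL-⇔ (λ i → subst (λ j → (lookup π i == j) ≡ true ⇔ lookup π i ≡ i)
  (sym (Vecₚ.lookup∘tabulate id i)) (==-⇔ (lookup π i) i))

allL-first-⇔ : (p : Fin (suc m) → Bool) {P : Set} → p zero ≡ true ⇔ P →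
  allL (allFin (suc m)) (λ i → not (isFirst i) ∨ p i) ≡ true ⇔ P
allL-first-⇔ p {P} p⇔P = mk⇔ (λ eq → to (allL-⇔ test) eq zero refl) (λ x → from (allL-⇔ test) λ { _ refl → x })
  where
  test : ∀ i → (not (isFirst i) ∨ p i) ≡ true ⇔ (i ≡ zero → P)
  test zero    = mk⇔ (λ eq _ → to p⇔P eq) (λ f → from p⇔P (f refl))
  test (suc i) = mk⇔ (λ _ ()) (λ _ → refl)

-- Arrays as functions of row and column

at : Array n → Fin n → Fin n → Fin n
at L i j = lookup (lookup L i) j

mk : (Fin n → Fin n → Fin n) → Array n
mk f = tabulate (λ i → tabulate (f i))

at-mk : (f : Fin n → Fin n → Fin n) → ∀ i j → at (mk f) i j ≡ f i j
at-mk f i j = trans (cong (λ v → lookup v j) (Vecₚ.lookup∘tabulate (λ i → tabulate (f i)) i)) (Vecₚ.lookup∘tabulate (f i) j)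

lookup-ext : {v w : Vec X n} → (∀ i → lookup v i ≡ lookup w i) → v ≡ w
lookup-ext {v = v} {w} eq = trans (sym (Vecₚ.tabulate∘lookup v)) (trans (Vecₚ.tabulate-cong eq) (Vecₚ.tabulate∘lookup w))

at-ext : {L M : Array n} → (∀ i j → at L i j ≡ at M i j) → L ≡ M
at-ext eq = lookup-ext (λ i → lookup-ext (eq i))

mk-ext : {f : Fin n → Fin n → Fin n} {M : Array n} → (∀ i j → f i j ≡ at M i j) → mk f ≡ M
mk-ext {f = f} eq = at-ext (λ i j → trans (at-mk f i j) (eq i j))

RowInj : (Fin n → Fin n → Fin n) → Set
RowInj f = ∀ i → Inj (f i)

ColInj : (Fin n → Fin n → Fin n) → Set
ColInj f = ∀ j → Inj (λ i → f i j)

Latin : (Fin n → Fin n → Fin n) → Set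
Latin f = RowInj f × ColInj f

RowInj-mk : {f : Fin n → Fin n → Fin n} → RowInj f → RowInj (at (mk f))
RowInj-mk {f = f} r i = Inj-cong (λ j → sym (at-mk f i j)) (r i)

Latin-mk : {f : Fin n → Fin n → Fin n} → Latin f → Latin (at (mk f))
Latin-mk {f = f} (r , c) = RowInj-mk r , (λ j → Inj-cong (λ i → sym (at-mk f i j)) (c j))

isLatinᵇ-⇔ : (L : Array n) → isLatinᵇ L ≡ true ⇔ Latin (at L)
isLatinᵇ-⇔ L = ∧-⇔ (allL-⇔ (λ i → injectiveᵇ-⇔ (rowOf L i)))
  (allL-⇔ (λ j → mk⇔
    (λ eq → Inj-cong (Vecₚ.lookup∘tabulate (λ i → at L i j)) (to (injectiveᵇ-⇔ (colOf L j)) eq))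
    (λ inj → from (injectiveᵇ-⇔ (colOf L j)) (Inj-cong (λ i → sym (Vecₚ.lookup∘tabulate (λ i → at L i j) i)) inj))))

FirstRowId FirstColId DiagFirst Unipotent : (Fin (suc m) → Fin (suc m) → Fin (suc m)) → Set
FirstRowId f = ∀ j → f zero j ≡ j
FirstColId f = ∀ i → f i zero ≡ i
DiagFirst f  = ∀ i → f i i ≡ zero
Unipotent f  = ∀ i j → f i i ≡ f j j

isNormalized-⇔ : (L : Array (suc m)) → isNormalized L ≡ true ⇔ FirstRowId (at L)
isNormalized-⇔ {m} L = allL-first-⇔ (λ i → samePerm (rowOf L i) (idPerm (suc m))) (samePerm-idPerm-⇔ (rowOf L zero))

firstColId-⇔ : (L : Array (suc m)) → firstColId L ≡ true ⇔ FirstColId (at L)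
firstColId-⇔ {m} L = allL-first-⇔ (λ j → samePerm (colOf L j) (idPerm (suc m))) (mk⇔
  (λ eq i → trans (sym (Vecₚ.lookup∘tabulate (λ i → at L i zero) i)) (to (samePerm-idPerm-⇔ (colOf L zero)) eq i))
  (λ ids → from (samePerm-idPerm-⇔ (colOf L zero)) (λ i → trans (Vecₚ.lookup∘tabulate (λ i → at L i zero) i) (ids i))))

isUnipotent-⇔ : (L : Array (suc m)) → isUnipotent L ≡ true ⇔ Unipotent (at L)
isUnipotent-⇔ L = allL-⇔ (λ i → allL-⇔ (λ j → ==-⇔ (at L i i) (at L j j)))

vecs-enumerates : ∀ n k → vecsOver (allFin n) k enumerates (λ _ → ⊤)
vecs-enumerates n k = enumerates-⇔ (λ _ → mk⇔ _ _) (vecsOver-enumerates (allFin-enumerates n) k)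

Sym-enumerates : ∀ n → Sym n enumerates (λ π → Inj (lookup π))
Sym-enumerates n = enumerates-⇔ (λ _ → mk⇔ proj₂ (_ ,_)) (select-enumerates injectiveᵇ-⇔ (vecs-enumerates n n))

tuples-enumerates : ∀ n → vecsOver (Sym n) n enumerates (λ σ → RowInj (at σ))
tuples-enumerates n = vecsOver-enumerates (Sym-enumerates n) n

LatinSquares-enumerates : ∀ n → LatinSquares n enumerates (λ L → Latin (at L))
LatinSquares-enumerates n = enumerates-⇔ (λ _ → mk⇔ proj₂ ((λ _ → _) ,_)) (select-enumerates isLatinᵇ-⇔
  (vecsOver-enumerates (vecs-enumerates n n) n))

-- The classes of Latin squares to be summed over

module _ (m : ℕ) where
  private N = suc m

  stabilizer : List (Perm N)
  stabilizer = select (λ π → lookup π zero == zero) (Sym N)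

  normalized reduced diagFirst normalizedUnipotent : List (Array N)
  normalized          = select isNormalized (LatinSquares N)
  reduced             = select isReduced (LatinSquares N)
  diagFirst           = select (λ L → allL (allFin N) λ i → at L i i == zero) (LatinSquares N)
  normalizedUnipotent = select (λ L → isNormalized L ∧ isUnipotent L) (LatinSquares N)

  stabilizer-enumerates : stabilizer enumerates (λ π → Inj (lookup π) × lookup π zero ≡ zero)
  stabilizer-enumerates = select-enumerates (λ π → ==-⇔ (lookup π zero) zero) (Sym-enumerates N)

  normalized-enumerates : normalized enumerates (λ L → Latin (at L) × FirstRowId (at L))
  normalized-enumerates = select-enumerates isNormalized-⇔ (LatinSquares-enumerates N)

  reduced-enumerates : reduced enumerates (λ L → Latin (at L) × FirstRowId (at L) × FirstColId (at L))
  reduced-enumerates = select-enumerates (λ L → ∧-⇔ (isNormalized-⇔ L) (firstColId-⇔ L)) (LatinSquares-enumerates N)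

  diagFirst-enumerates : diagFirst enumerates (λ L → Latin (at L) × DiagFirst (at L))
  diagFirst-enumerates = select-enumerates (λ L → allL-⇔ (λ i → ==-⇔ (at L i i) zero)) (LatinSquares-enumerates N)

  normalizedUnipotent-enumerates :
    normalizedUnipotent enumerates (λ L → Latin (at L) × FirstRowId (at L) × Unipotent (at L))
  normalizedUnipotent-enumerates =
    select-enumerates (λ L → ∧-⇔ (isNormalized-⇔ L) (isUnipotent-⇔ L)) (LatinSquares-enumerates N)

-- Row signs and column signs

∏-allFin-suc : (f : Fin (suc m) → ℤ) → ∏ (allFin (suc m)) f ≡ f zero * ∏ (allFin m) (f ∘ suc)
∏-allFin-suc {m} f = cong (λ xs → f zero * prodℤ xs)
  (trans (Listₚ.map-tabulate suc f) (sym (Listₚ.map-tabulate id (f ∘ suc))))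

rowsSign-cong : {f g : Fin n → Fin n → Fin n} → (∀ i j → f i j ≡ g i j) → rowsSign f ≡ rowsSign g
rowsSign-cong {n} eq = ∏-cong (allFin n) (λ i → ε-cong (eq i))

colsSign-cong : {f g : Fin n → Fin n → Fin n} → (∀ i j → f i j ≡ g i j) → colsSign f ≡ colsSign g
colsSign-cong {n} eq = ∏-cong (allFin n) (λ j → ε-cong (λ i → eq i j))

rowsSign-unit : {f : Fin n → Fin n → Fin n} → RowInj f → Unit (rowsSign f)
rowsSign-unit {n} r = unit-∏ (allFin n) (λ i → ε-unit (r i))

colsSign-unit : {f : Fin n → Fin n → Fin n} → ColInj f → Unit (colsSign f)
colsSign-unit {n} c = unit-∏ (allFin n) (λ j → ε-unit (c j))

-- The line of index 1 is left out: `signFirst` makes the sign of σ_1 a square, and composing every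
-- σ_i with column i of ρ then changes only the signs with i different from 1.
tailRowsSign tailColsSign : (Fin (suc m) → Fin (suc m) → Fin (suc m)) → ℤ
tailRowsSign {m} L = ∏ (allFin m) (λ i → ε (L (suc i)))
tailColsSign {m} L = ∏ (allFin m) (λ j → ε (λ i → L i (suc j)))

rowsSign≡tailRowsSign : (f : Fin (suc m) → Fin (suc m) → Fin (suc m)) → FirstRowId f → rowsSign f ≡ tailRowsSign f
rowsSign≡tailRowsSign {m} f r = trans (∏-allFin-suc (λ i → ε (f i)))
  (trans (cong (_* tailRowsSign f) (trans (ε-cong r) (ε-id {suc m}))) (ℤₚ.*-identityˡ (tailRowsSign f)))

colsSign≡tailColsSign : (f : Fin (suc m) → Fin (suc m) → Fin (suc m)) → FirstColId f → colsSign f ≡ tailColsSign f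
colsSign≡tailColsSign {m} f c = trans (∏-allFin-suc (λ j → ε (λ i → f i j)))
  (trans (cong (_* tailColsSign f) (trans (ε-cong c) (ε-id {suc m}))) (ℤₚ.*-identityˡ (tailColsSign f)))

∏-*-const : (f : Fin n → ℤ) (c : ℤ) → ∏ (allFin n) (λ i → f i * c) ≡ ∏ (allFin n) f * c ^ n
∏-*-const {n} f c = trans (∏-* (allFin n) f (λ _ → c)) (cong (∏ (allFin n) f *_)
  (trans (∏-const c (allFin n)) (cong (c ^_) (Listₚ.length-tabulate {n = n} id))))

-- Normalising Latin squares

-- The conjugate (parastrophe) that exchanges rows with symbols. Each column becomes the inverse
-- permutation, so the operation is an involution on Latin squares and preserves the column signs.
conj : (Fin n → Fin n → Fin n) → Fin n → Fin n → Fin n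
conj f r c = inv (λ s → f s c) r

module _ {f : Fin n → Fin n → Fin n} (lat : Latin f) where

  f∘conj : ∀ s c → f (conj f s c) c ≡ s
  f∘conj s c = f∘inv (λ r → f r c) (proj₂ lat c) s

  conj∘f : ∀ r c → conj f (f r c) c ≡ r
  conj∘f r c = inv∘f (λ r → f r c) (proj₂ lat c) r

  conj-Latin : Latin (conj f)
  conj-Latin = (λ r c c′ eq → proj₁ lat (conj f r c) c c′
                  (trans (f∘conj r c) (sym (trans (cong (λ s → f s c′) eq) (f∘conj r c′)))))
             , (λ c → inv-Inj (λ s → f s c) (proj₂ lat c))

  colsSign-conj : colsSign (conj f) ≡ colsSign f
  colsSign-conj = ∏-cong (allFin n) (λ c → sym
    (ε-inverse (λ r → f r c) (λ r → conj f r c) (proj₂ lat c) (proj₂ conj-Latin c) (λ s → f∘conj s c)))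

  -- The rows of `f` are the symbol permutations of `conj f`, so `rows*cols*symbols` applies to
  -- `conj f`; the factors, being signs, can be moved to the other side.
  rowsSign-conj : rowsSign (conj f) ≡ -1ℤ ^ triangular n * (rowsSign f * colsSign f)
  rowsSign-conj = begin
    rowsSign (conj f)
      ≡⟨ sym (ℤₚ.*-identityʳ _) ⟩
    rowsSign (conj f) * 1ℤ
      ≡⟨ cong (rowsSign (conj f) *_) (sym (unit-² (unit-* (colsSign-unit (proj₂ lat)) (rowsSign-unit (proj₁ lat))))) ⟩
    rowsSign (conj f) * (colsSign f * rowsSign f * (colsSign f * rowsSign f))
      ≡⟨ regroup (rowsSign (conj f)) (colsSign f) (rowsSign f) ⟩
    rowsSign (conj f) * colsSign f * rowsSign f * (rowsSign f * colsSign f)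
      ≡⟨ cong (λ z → rowsSign (conj f) * z * rowsSign f * (rowsSign f * colsSign f)) (sym colsSign-conj) ⟩
    rowsSign (conj f) * colsSign (conj f) * rowsSign f * (rowsSign f * colsSign f)
      ≡⟨ cong (_* (rowsSign f * colsSign f)) (rows*cols*symbols (conj f) f (λ r → inv (conj f r)) f∘conj conj∘f
           (λ r → inv∘f (conj f r) (proj₁ conj-Latin r)) (λ r → f∘inv (conj f r) (proj₁ conj-Latin r))) ⟩
    -1ℤ ^ triangular n * (rowsSign f * colsSign f) ∎
    where
    open ≡-Reasoning
    regroup : ∀ x y z → x * (y * z * (y * z)) ≡ x * y * z * (z * y)
    regroup = solve-∀

conj-cong : {f g : Fin n → Fin n → Fin n} → Latin g → (∀ i j → f i j ≡ g i j) → ∀ i j → conj f i j ≡ conj g i j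
conj-cong {f = f} {g} lat eq r c = inv-cong (λ s → f s c) (λ s → g s c) (proj₂ lat c) (λ s → eq s c) r

conj-conj : {f : Fin n → Fin n → Fin n} → Latin f → ∀ i j → conj (conj f) i j ≡ f i j
conj-conj {f = f} lat r c = inv-unique (λ s → conj f s c) (λ s → f s c) (proj₂ (conj-Latin lat) c)
  (λ s → conj∘f lat s c) r

module _ (m : ℕ) where
  private
    N = suc m
    Arr = Array N

  -- `L zero c ≡ c` puts symbol c into row `zero` of column c. With rows and symbols exchanged, this
  -- puts symbol `zero` into the cell (c, c), so `conj` interchanges the two classes.
  ∑-normalized-conj :
    ∑ (normalized m) (λ L → rowsSign (at L)) ≡
    -1ℤ ^ triangular N * ∑ (diagFirst m) (λ L → rowsSign (at L) * colsSign (at L))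
  ∑-normalized-conj = trans
    (∑-reindex (diagFirst-enumerates m) (normalized-enumerates m) conjA conjA
      (λ L (lat , diag) → Latin-mk (conj-Latin lat) , λ c → trans (at-mk (conj (at L)) zero c)
          (proj₂ lat c _ _ (trans (f∘conj lat zero c) (sym (diag c)))))
      (λ L (lat , fst) → Latin-mk (conj-Latin lat) , λ c → trans (at-mk (conj (at L)) c c)
          (proj₂ lat c _ _ (trans (f∘conj lat c c) (sym (fst c)))))
      (λ L (lat , _) → conjA-conjA L lat) (λ L (lat , _) → conjA-conjA L lat)
      (λ L → rowsSign (at L)) (λ L → -1ℤ ^ triangular N * (rowsSign (at L) * colsSign (at L)))
      (λ L (lat , _) → trans (rowsSign-cong (at-mk (conj (at L)))) (rowsSign-conj lat)))
    (∑-*ˡ (-1ℤ ^ triangular N) (diagFirst m) (λ L → rowsSign (at L) * colsSign (at L)))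
    where
    conjA : Arr → Arr
    conjA L = mk (conj (at L))
    conjA-conjA : ∀ L → Latin (at L) → conjA (conjA L) ≡ L
    conjA-conjA L lat = mk-ext (λ i j →
      trans (conj-cong (conj-Latin lat) (at-mk (conj (at L))) i j) (conj-conj lat i j))

  -- Relabelling the symbols by the inverse of the first row normalizes the square and keeps its
  -- diagonal constant; the first row fixes `zero` because the corner lies on the diagonal. All n
  -- row signs and all n column signs change by the same factor, and 2n equal signs cancel.
  ∑-diagFirst :
    ∑ (diagFirst m) (λ L → rowsSign (at L) * colsSign (at L)) ≡
    + length (stabilizer m) * ∑ (normalizedUnipotent m) (λ L → rowsSign (at L) * colsSign (at L))
  ∑-diagFirst = trans
    (∑-reindex (cartesianProduct-enumerates (stabilizer-enumerates m) (normalizedUnipotent-enumerates m))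
      (diagFirst-enumerates m) φ ψ
      (λ (π , L) ((π-inj , π0) , (r , c) , fst , uni) →
        Latin-mk {f = act π L} ((λ i → Inj-∘ π-inj (r i)) , (λ j → Inj-∘ π-inj (c j))) ,
        λ i → trans (at-mk (act π L) i i) (trans (cong (lookup π) (trans (uni i zero) (fst zero))) π0))
      (λ M ((r , c) , diag) →
        (r zero , diag zero) ,
        Latin-mk {f = unact M} ((λ i → Inj-∘ (inv-Inj _ (r zero)) (r i)) , (λ j → Inj-∘ (inv-Inj _ (r zero)) (c j))) ,
        (λ j → trans (at-mk (unact M) zero j) (inv∘f _ (r zero) j)) ,
        (λ i j → trans (at-mk (unact M) i i) (trans (cong (inv (at M zero)) (trans (diag i) (sym (diag j)))) (sym (at-mk (unact M) j j)))))
      (λ (π , L) ((π-inj , _) , lat , fst , _) →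
        -- The first row of L is the identity, so the first row of the relabelled square is π
        -- itself, and `ψ` reads π off from there.
        let row₀ = λ j → trans (at-mk (act π L) zero j) (cong (lookup π) (fst j)) in
        cong₂ _,_ (lookup-ext row₀)
          (mk-ext (λ i j → trans (inv-cong _ (lookup π) π-inj row₀ _)
            (trans (cong (inv (lookup π)) (at-mk (act π L) i j)) (inv∘f _ π-inj _)))))
      (λ M ((r , _) , _) → mk-ext (λ i j → trans (cong (at M zero) (at-mk (unact M) i j)) (f∘inv _ (r zero) _)))
      w (w ∘ proj₂) weight)
    (∑-cartesianProduct (stabilizer m) (normalizedUnipotent m) w)
    where
    w : Arr → ℤ
    w L = rowsSign (at L) * colsSign (at L)
    act : Perm N → Arr → Fin N → Fin N → Fin N
    act π L i j = lookup π (at L i j)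
    unact : Arr → Fin N → Fin N → Fin N
    unact M i j = inv (at M zero) (at M i j)
    φ : Perm N × Arr → Arr
    φ (π , L) = mk (act π L)
    ψ : Arr → Perm N × Arr
    ψ M = lookup M zero , mk (unact M)
    lem : ∀ e r c → (r * e) * (c * e) ≡ e * e * (r * c)
    lem = solve-∀
    weight : ∀ πL → _ → w (φ πL) ≡ w (proj₂ πL)
    weight (π , L) ((π-inj , _) , (r , c) , _) = begin
      w (φ (π , L))
        ≡⟨ cong₂ _*_
             (trans (rowsSign-cong (at-mk (act π L))) (trans (∏-cong (allFin N)
                (λ i → trans (ε-∘ (lookup π) (at L i) (r i)) (ℤₚ.*-comm (ε (lookup π)) _)))
                (∏-*-const (λ i → ε (at L i)) (ε (lookup π)))))
             (trans (colsSign-cong (at-mk (act π L))) (trans (∏-cong (allFin N)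
                (λ j → trans (ε-∘ (lookup π) (λ i → at L i j) (c j)) (ℤₚ.*-comm (ε (lookup π)) _)))
                (∏-*-const (λ j → ε (λ i → at L i j)) (ε (lookup π))))) ⟩
      (rowsSign (at L) * e) * (colsSign (at L) * e)
        ≡⟨ lem e (rowsSign (at L)) (colsSign (at L)) ⟩
      e * e * w L
        ≡⟨ trans (cong (_* w L) (unit-² (unit-^ (ε-unit π-inj) N))) (ℤₚ.*-identityˡ (w L)) ⟩
      w L ∎
      where
      open ≡-Reasoning
      e = ε (lookup π) ^ N

  module _ (m-even : ∀ {z} → Unit z → z ^ m ≡ 1ℤ) where

    -- A Latin square arises from exactly one normalized square by permuting columns, the
    -- permutation τ being its own first row. Each of the m other rows gains the factor `ε τ`, and m
    -- is even.
    ∑-LatinSquares :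
      ∑ (LatinSquares N) (λ L → tailRowsSign (at L)) ≡
      + length (Sym N) * ∑ (normalized m) (λ L → rowsSign (at L))
    ∑-LatinSquares = trans
      (∑-reindex (cartesianProduct-enumerates (Sym-enumerates N) (normalized-enumerates m))
        (LatinSquares-enumerates N) φ ψ
        (λ (τ , L) (τ-inj , (r , c) , _) →
          Latin-mk {f = act τ L} ((λ i → Inj-∘ (r i) τ-inj) , (λ j → c (lookup τ j))))
        (λ M (r , c) →
          r zero ,
          Latin-mk {f = unact M} ((λ i → Inj-∘ (r i) (inv-Inj _ (r zero))) , (λ j → c (inv (at M zero) j))) ,
          (λ j → trans (at-mk (unact M) zero j) (f∘inv _ (r zero) j)))
        (λ (τ , L) (τ-inj , _ , fst) →
          let row₀ = λ j → trans (at-mk (act τ L) zero j) (fst (lookup τ j)) in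
          cong₂ _,_ (lookup-ext row₀)
            (mk-ext (λ i j → trans (at-mk (act τ L) i _) (cong (at L i)
              (trans (cong (lookup τ) (inv-cong _ (lookup τ) τ-inj row₀ j)) (f∘inv _ τ-inj j))))))
        (λ M (r , _) → mk-ext (λ i j → trans (at-mk (unact M) i _) (cong (at M i) (inv∘f _ (r zero) j))))
        (λ L → tailRowsSign (at L)) ((λ L → rowsSign (at L)) ∘ proj₂) weight)
      (∑-cartesianProduct (Sym N) (normalized m) (λ L → rowsSign (at L)))
      where
      act : Perm N → Arr → Fin N → Fin N → Fin N
      act τ L i j = at L i (lookup τ j)
      unact : Arr → Fin N → Fin N → Fin N
      unact M i j = at M i (inv (at M zero) j)
      φ : Perm N × Arr → Arr
      φ (τ , L) = mk (act τ L)
      ψ : Arr → Perm N × Arr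
      ψ M = lookup M zero , mk (unact M)
      weight : ∀ τL → _ → tailRowsSign (at (φ τL)) ≡ rowsSign (at (proj₂ τL))
      weight (τ , L) (τ-inj , _ , fst) = begin
        tailRowsSign (at (φ (τ , L)))
          ≡⟨ ∏-cong (allFin m) (λ i → trans (ε-cong (at-mk (act τ L) (suc i))) (ε-∘ (at L (suc i)) (lookup τ) τ-inj)) ⟩
        ∏ (allFin m) (λ i → ε (at L (suc i)) * ε (lookup τ))
          ≡⟨ ∏-*-const (λ i → ε (at L (suc i))) (ε (lookup τ)) ⟩
        tailRowsSign (at L) * ε (lookup τ) ^ m
          ≡⟨ trans (cong (tailRowsSign (at L) *_) (m-even (ε-unit τ-inj))) (ℤₚ.*-identityʳ _) ⟩
        tailRowsSign (at L)
          ≡⟨ sym (rowsSign≡tailRowsSign (at L) fst) ⟩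
        rowsSign (at L) ∎
        where open ≡-Reasoning

    -- The same idea with rows: κ is the first column, which fixes `zero` because the first row is
    -- the identity. The row signs are merely reordered, while each of the m columns other than the
    -- first gains `ε κ`.
    ∑-normalized-reduced :
      ∑ (normalized m) (λ L → rowsSign (at L) * tailColsSign (at L)) ≡
      + length (stabilizer m) * ∑ (reduced m) (λ L → rowsSign (at L) * colsSign (at L))
    ∑-normalized-reduced = trans
      (∑-reindex (cartesianProduct-enumerates (stabilizer-enumerates m) (reduced-enumerates m))
        (normalized-enumerates m) φ ψ
        (λ (κ , L) ((κ-inj , κ0) , (r , c) , fst , _) →
          Latin-mk {f = act κ L} ((λ i → r (lookup κ i)) , (λ j → Inj-∘ (c j) κ-inj)) ,
          (λ j → trans (at-mk (act κ L) zero j) (trans (cong (λ i → at L i j) κ0) (fst j))))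
        (λ M ((r , c) , fst) →
          (Inj-cong (λ i → sym (Vecₚ.lookup∘tabulate (col₀ M) i)) (c zero) , fst zero) ,
          Latin-mk {f = unact M} ((λ i → r (inv (col₀ M) i)) , (λ j → Inj-∘ (c j) (inv-Inj _ (c zero)))) ,
          -- The first column fixes `zero`, hence so does its inverse, and the first row stays in
          -- place.
          (λ j → trans (at-mk (unact M) zero j) (trans (cong (λ i → at M i j)
            (c zero _ _ (trans (f∘inv _ (c zero) zero) (sym (fst zero))))) (fst j))) ,
          (λ i → trans (at-mk (unact M) i zero) (f∘inv _ (c zero) i)))
        (λ (κ , L) ((κ-inj , _) , _ , _ , fst) →
          let col = λ i → trans (at-mk (act κ L) i zero) (fst (lookup κ i)) in
          cong₂ _,_ (lookup-ext (λ i → trans (Vecₚ.lookup∘tabulate (col₀ (φ (κ , L))) i) (col i)))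
            (mk-ext (λ i j → trans (at-mk (act κ L) _ j) (cong (λ i → at L i j)
              (trans (cong (lookup κ) (inv-cong _ (lookup κ) κ-inj col i)) (f∘inv _ κ-inj i))))))
        (λ M ((_ , c) , _) → mk-ext (λ i j → trans (at-mk (unact M) _ j) (cong (λ i → at M i j)
          (trans (cong (inv (col₀ M)) (Vecₚ.lookup∘tabulate (col₀ M) i)) (inv∘f _ (c zero) i)))))
        (λ L → rowsSign (at L) * tailColsSign (at L)) ((λ L → rowsSign (at L) * colsSign (at L)) ∘ proj₂) weight)
      (∑-cartesianProduct (stabilizer m) (reduced m) (λ L → rowsSign (at L) * colsSign (at L)))
      where
      col₀ : Arr → Fin N → Fin N
      col₀ M i = at M i zero
      act : Perm N → Arr → Fin N → Fin N → Fin N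
      act κ L i j = at L (lookup κ i) j
      unact : Arr → Fin N → Fin N → Fin N
      unact M i j = at M (inv (col₀ M) i) j
      φ : Perm N × Arr → Arr
      φ (κ , L) = mk (act κ L)
      ψ : Arr → Perm N × Arr
      ψ M = colOf M zero , mk (unact M)
      weight : ∀ κL → _ → rowsSign (at (φ κL)) * tailColsSign (at (φ κL)) ≡
                          rowsSign (at (proj₂ κL)) * colsSign (at (proj₂ κL))
      weight (κ , L) ((κ-inj , _) , _ , _ , fst) = cong₂ _*_
        (begin
          rowsSign (at (φ (κ , L)))
            ≡⟨ rowsSign-cong (at-mk (act κ L)) ⟩
          ∏ (allFin N) (λ i → ε (at L (lookup κ i)))
            ≡⟨ sym (∏-map (lookup κ) (allFin N) (λ i → ε (at L i))) ⟩
          ∏ (map (lookup κ) (allFin N)) (λ i → ε (at L i))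
            ≡⟨ ∏-↭ (λ i → ε (at L i)) (map-allFin-↭ (lookup κ) κ-inj) ⟩
          rowsSign (at L) ∎)
        (begin
          tailColsSign (at (φ (κ , L)))
            ≡⟨ ∏-cong (allFin m) (λ j → trans (ε-cong (λ i → at-mk (act κ L) i (suc j))) (ε-∘ (λ i → at L i (suc j)) (lookup κ) κ-inj)) ⟩
          ∏ (allFin m) (λ j → ε (λ i → at L i (suc j)) * ε (lookup κ))
            ≡⟨ ∏-*-const (λ j → ε (λ i → at L i (suc j))) (ε (lookup κ)) ⟩
          tailColsSign (at L) * ε (lookup κ) ^ m
            ≡⟨ trans (cong (tailColsSign (at L) *_) (m-even (ε-unit κ-inj))) (ℤₚ.*-identityʳ _) ⟩
          tailColsSign (at L)
            ≡⟨ sym (colsSign≡tailColsSign (at L) fst) ⟩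
          colsSign (at L) ∎)
        where open ≡-Reasoning

-- Selection along maps and under equal tests

select-map : (p : Y → Bool) (f : X → Y) (xs : List X) → select p (map f xs) ≡ map f (select (p ∘ f) xs)
select-map p f []       = refl
select-map p f (x ∷ xs) with p (f x)
... | true  = cong (f x ∷_) (select-map p f xs)
... | false = select-map p f xs

select-cong : {p q : X → Bool} → (∀ x → p x ≡ q x) → ∀ xs → select p xs ≡ select q xs
select-cong p≗q []       = refl
select-cong {p = p} {q} p≗q (x ∷ xs) rewrite p≗q x with q x
... | true  = cong (x ∷_) (select-cong p≗q xs)
... | false = select-cong p≗q xs

select-false : (xs : List X) → select (λ _ → false) xs ≡ []
select-false []       = refl
select-false (x ∷ xs) = select-false xs

-- Numbers of permutations

-- The recursion behind n!: a permutation is its first value together with the pattern of the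
-- remaining values, relabelled to skip that value.
insert : Fin (suc n) → Perm n → Perm (suc n)
insert a π = a ∷ tabulate (λ i → punchIn a (lookup π i))

-- A total version of `punchOut`. The last argument is a default for equal points, a case that does
-- not arise when an injective π is taken apart.
punchOut′ : Fin (suc n) → Fin (suc n) → Fin n → Fin n
punchOut′ a b i with a Finₚ.≟ b
... | yes _  = i
... | no a≢b = punchOut a≢b

remove : Perm (suc n) → Perm n
remove π = tabulate (λ i → punchOut′ (lookup π zero) (lookup π (suc i)) i)

punchOut′-punchIn : (a : Fin (suc n)) (b i : Fin n) → punchOut′ a (punchIn a b) i ≡ b
punchOut′-punchIn a b i with a Finₚ.≟ punchIn a b
... | yes a≡ = contradiction (sym a≡) (Finₚ.punchInᵢ≢i a b)
... | no a≢  = trans (Finₚ.punchOut-cong a refl) (Finₚ.punchOut-punchIn a)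

punchIn-punchOut′ : {a b : Fin (suc n)} (i : Fin n) → a ≢ b → punchIn a (punchOut′ a b i) ≡ b
punchIn-punchOut′ {a = a} {b} i a≢b with a Finₚ.≟ b
... | yes a≡b = contradiction a≡b a≢b
... | no a≢b′ = Finₚ.punchIn-punchOut a≢b′

lookup-insert : (a : Fin (suc n)) (π : Perm n) (i : Fin n) → lookup (insert a π) (suc i) ≡ punchIn a (lookup π i)
lookup-insert a π = Vecₚ.lookup∘tabulate (λ i → punchIn a (lookup π i))

insert-Inj : (a : Fin (suc n)) (π : Perm n) → Inj (lookup π) → Inj (lookup (insert a π))
insert-Inj a π π-inj zero    zero    eq = refl
insert-Inj a π π-inj zero    (suc j) eq = contradiction (trans (sym (lookup-insert a π j)) (sym eq)) (Finₚ.punchInᵢ≢i a _)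
insert-Inj a π π-inj (suc i) zero    eq = contradiction (trans (sym (lookup-insert a π i)) eq) (Finₚ.punchInᵢ≢i a _)
insert-Inj a π π-inj (suc i) (suc j) eq = cong suc (π-inj i j (Finₚ.punchIn-injective a _ _
  (trans (sym (lookup-insert a π i)) (trans eq (lookup-insert a π j)))))

lookup-remove : (π : Perm (suc n)) → Inj (lookup π) → ∀ i → punchIn (lookup π zero) (lookup (remove π) i) ≡ lookup π (suc i)
lookup-remove π π-inj i = trans
  (cong (punchIn (lookup π zero)) (Vecₚ.lookup∘tabulate (λ i → punchOut′ (lookup π zero) (lookup π (suc i)) i) i))
  (punchIn-punchOut′ i (λ eq → contradiction (π-inj _ _ eq) λ ()))

remove-Inj : (π : Perm (suc n)) → Inj (lookup π) → Inj (lookup (remove π))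
remove-Inj π π-inj i j eq = Finₚ.suc-injective (π-inj _ _ (trans (sym (lookup-remove π π-inj i))
  (trans (cong (punchIn (lookup π zero)) eq) (lookup-remove π π-inj j))))

remove-insert : (a : Fin (suc n)) (π : Perm n) → remove (insert a π) ≡ π
remove-insert a π = lookup-ext (λ i → trans (Vecₚ.lookup∘tabulate (λ i → punchOut′ a (lookup (insert a π) (suc i)) i) i)
  (trans (cong (λ b → punchOut′ a b i) (lookup-insert a π i)) (punchOut′-punchIn a (lookup π i) i)))

insert-remove : (π : Perm (suc n)) → Inj (lookup π) → insert (lookup π zero) (remove π) ≡ π
insert-remove π π-inj = lookup-ext λ
  { zero    → refl
  ; (suc i) → trans (lookup-insert (lookup π zero) (remove π) i) (lookup-remove π π-inj i) }

length-stabilizer : ∀ m → length (stabilizer m) ≡ length (Sym m)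
length-stabilizer m = sym (trans (sym (Listₚ.length-map (insert zero) (Sym m)))
  (↭-length (enumerates⇒↭
    (map-enumerates (insert zero) remove
      (λ π π-inj → insert-Inj zero π π-inj , refl)
      (λ π (π-inj , _) → remove-Inj π π-inj)
      (λ π _ → remove-insert zero π)
      (λ π (π-inj , π0) → trans (cong (λ a → insert a (remove π)) (sym π0)) (insert-remove π π-inj))
      (Sym-enumerates m))
    (stabilizer-enumerates m))))

length-cartesianProduct : (xs : List X) (ys : List Y) → length (cartesianProduct xs ys) ≡ length xs ℕ.* length ys
length-cartesianProduct []       ys = refl
length-cartesianProduct (x ∷ xs) ys = trans (Listₚ.length-++ (map (x ,_) ys))
  (cong₂ ℕ._+_ (Listₚ.length-map (x ,_) ys) (length-cartesianProduct xs ys))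

length-Sym : ∀ n → length (Sym n) ≡ n !
length-Sym zero    = refl
length-Sym (suc n) = begin
  length (Sym (suc n))
    ≡⟨ ↭-length (enumerates⇒↭ (Sym-enumerates (suc n))
         (map-enumerates (λ (a , π) → insert a π) (λ π → lookup π zero , remove π)
           (λ (a , π) (_ , π-inj) → insert-Inj a π π-inj)
           (λ π π-inj → _ , remove-Inj π π-inj)
           (λ (a , π) _ → cong (a ,_) (remove-insert a π))
           insert-remove
           (cartesianProduct-enumerates (allFin-enumerates (suc n)) (Sym-enumerates n)))) ⟩
  length (map (λ (a , π) → insert a π) (cartesianProduct (allFin (suc n)) (Sym n)))
    ≡⟨ Listₚ.length-map _ (cartesianProduct (allFin (suc n)) (Sym n)) ⟩
  length (cartesianProduct (allFin (suc n)) (Sym n))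
    ≡⟨ length-cartesianProduct (allFin (suc n)) (Sym n) ⟩
  length (allFin (suc n)) ℕ.* length (Sym n)
    ≡⟨ cong₂ ℕ._*_ (Listₚ.length-tabulate {n = suc n} id) (length-Sym n) ⟩
  suc n ! ∎
  where open ≡-Reasoning

-- Signed counts

-- A difference of even and odd counts becomes a sum of signs, provided that no third value occurs.
-- `signLS` satisfies this on every array, since `sign` is a power of -1.
signed-count : (p : X → Bool) (s : X → ℤ) → (∀ x → Unit (s x)) → ∀ xs →
  + length (select (λ x → p x ∧ does (s x ℤ.≟ 1ℤ)) xs) ℤ.- + length (select (λ x → p x ∧ does (s x ℤ.≟ -1ℤ)) xs)
  ≡ ∑ (select p xs) s
signed-count p s u []       = refl
signed-count p s u (x ∷ xs) with p x
... | false = signed-count p s u xs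
... | true with s x | u x
...   | _ | inj₁ refl = trans (lem evens odds) (cong (λ z → 1ℤ + z) (signed-count p s u xs))
  where
  evens = + length (select (λ x → p x ∧ does (s x ℤ.≟ 1ℤ)) xs)
  odds  = + length (select (λ x → p x ∧ does (s x ℤ.≟ -1ℤ)) xs)
  lem : ∀ a b → (1ℤ + a) ℤ.- b ≡ 1ℤ + (a ℤ.- b)
  lem = solve-∀
...   | _ | inj₂ refl = trans (lem evens odds) (cong (λ z → -1ℤ + z) (signed-count p s u xs))
  where
  evens = + length (select (λ x → p x ∧ does (s x ℤ.≟ 1ℤ)) xs)
  odds  = + length (select (λ x → p x ∧ does (s x ℤ.≟ -1ℤ)) xs)
  lem : ∀ a b → a ℤ.- (1ℤ + b) ≡ -1ℤ + (a ℤ.- b)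
  lem = solve-∀

signLS-unit : (L : Array n) → Unit (signLS L)
signLS-unit {n} L = unit-* (unit-∏ (allFin n) (λ i → unit-^ (inj₂ refl) (inversions (rowOf L i))))
                           (unit-∏ (allFin n) (λ j → unit-^ (inj₂ refl) (inversions (colOf L j))))

signTuple≡rowsSign : (σ : Array n) → RowInj (at σ) → signTuple σ ≡ rowsSign (at σ)
signTuple≡rowsSign {n} σ r = ∏-cong (allFin n) (λ i → sign≡ε (lookup σ i) (r i))

signLS≡ : (L : Array n) → Latin (at L) → signLS L ≡ rowsSign (at L) * colsSign (at L)
signLS≡ {n} L (r , c) = cong₂ _*_ (signTuple≡rowsSign L r)
  (∏-cong (allFin n) (λ j → trans
    (sign≡ε (colOf L j) (Inj-cong (λ i → sym (Vecₚ.lookup∘tabulate (λ i → at L i j) i)) (c j)))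
    (ε-cong (Vecₚ.lookup∘tabulate (λ i → at L i j)))))

R-E-R-O : ∀ m → + R-E (suc m) ℤ.- + R-O (suc m) ≡ ∑ (reduced m) (λ L → rowsSign (at L) * colsSign (at L))
R-E-R-O m = trans (signed-count isReduced signLS signLS-unit (LatinSquares (suc m)))
  (∑-cong (reduced m) (λ {L} L∈ → signLS≡ L (proj₁ (sound (reduced-enumerates m) L∈))))

AT≡ : ∀ m → AT (suc m) ≡ ∑ (normalizedUnipotent m) (λ L → rowsSign (at L) * colsSign (at L))
AT≡ m = trans
  (cong₂ (λ xs ys → + length xs ℤ.- + length ys)
    (select-cong (λ L → sym (∧-assoc (isNormalized L) (isUnipotent L) (isEvenLS L))) (LatinSquares (suc m)))
    (select-cong (λ L → sym (∧-assoc (isNormalized L) (isUnipotent L) (isOddLS L))) (LatinSquares (suc m))))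
  (trans (signed-count (λ L → isNormalized L ∧ isUnipotent L) signLS signLS-unit (LatinSquares (suc m)))
    (∑-cong (normalizedUnipotent m) (λ {L} L∈ → signLS≡ L (proj₁ (sound (normalizedUnipotent-enumerates m) L∈)))))

-- The monomials equal to the product of all variables

-- No variable occurs twice in the monomial: superimposing f on the transpose of r gives distinct
-- pairs. The transpose comes from the index pattern (σ_i(j), ρ_j(i)).
Orthogonal : (Fin n → Fin n → Fin n) → (Fin n → Fin n → Fin n) → Set
Orthogonal r f = ∀ i j i′ j′ → f i j ≡ f i′ j′ → r j i ≡ r j′ i′ → i ≡ i′ × j ≡ j′

Inj⇒surjective₂ : (F : Fin n × Fin n → Fin n × Fin n) → Inj F → ∀ q → ∃ λ p → F p ≡ q
Inj⇒surjective₂ {n} F F-inj q =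
  let (x , eq) = Inj⇒surjective (enc ∘ F ∘ dec)
                   (λ x y eq → dec-inj x y (F-inj _ _ (enc-inj _ _ eq))) (enc q)
  in dec x , enc-inj _ _ eq
  where
  enc : Fin n × Fin n → Fin (n ℕ.* n)
  enc (i , j) = combine i j
  dec : Fin (n ℕ.* n) → Fin n × Fin n
  dec = remQuot n
  enc-inj : Inj enc
  enc-inj (i , j) (i′ , j′) eq = trans (sym (Finₚ.remQuot-combine i j)) (trans (cong dec eq) (Finₚ.remQuot-combine i′ j′))
  dec-inj : Inj dec
  dec-inj x y eq = trans (sym (Finₚ.combine-remQuot {n} n x)) (trans (cong enc eq) (Finₚ.combine-remQuot {n} n y))

hasAllVars : Array n → Array n → Bool
hasAllVars {n} ρ σ = sameMonomial (proj₂ (term ρ σ)) (allVars n)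

-- There are as many cells as variables, so if no variable is hit twice, each is hit exactly once.
hasAllVars-⇔ : (ρ σ : Array n) → hasAllVars ρ σ ≡ true ⇔ Orthogonal (at ρ) (at σ)
hasAllVars-⇔ {n} ρ σ = mk⇔
  (λ eq i j i′ j′ eqf eqr →
    let ij≡ = length-1 (fibre _ _) (to counts eq (at σ i j) (at ρ j i))
                (complete (fibre-enumerates _ _) {i , j} (_ , refl , refl))
                (complete (fibre-enumerates _ _) {i′ , j′} (_ , sym eqf , sym eqr))
    in cong proj₁ ij≡ , cong proj₂ ij≡)
  (λ orth → from counts (λ a b →
    let (p , Fp) = Inj⇒surjective₂ F (λ (i , j) (i′ , j′) eq →
                     let (i≡ , j≡) = orth i j i′ j′ (cong proj₁ eq) (cong proj₂ eq) in cong₂ _,_ i≡ j≡) (a , b)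
    in ↭-length (enumerates⇒↭ (fibre-enumerates a b) (enumeration ([] ∷ [])
         (λ { (here refl) → _ , cong proj₁ Fp , cong proj₂ Fp })
         (λ {q} (_ , eq₁ , eq₂) → let (i≡ , j≡) = orth (proj₁ q) (proj₂ q) (proj₁ p) (proj₂ p)
                                                     (trans eq₁ (sym (cong proj₁ Fp))) (trans eq₂ (sym (cong proj₂ Fp)))
                                  in here (cong₂ _,_ i≡ j≡))))))
  where
  F : Fin n × Fin n → Fin n × Fin n
  F (i , j) = at σ i j , at ρ j i
  hits : Fin n → Fin n → Fin n × Fin n → Bool
  hits a b p = (proj₁ p == a) ∧ (proj₂ p == b)
  fibre : Fin n → Fin n → List (Fin n × Fin n)
  fibre a b = select (hits a b ∘ F) (grid n)
  fibre-enumerates : ∀ a b → fibre a b enumerates (λ p → ⊤ × proj₁ (F p) ≡ a × proj₂ (F p) ≡ b)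
  fibre-enumerates a b = select-enumerates (λ p → ∧-⇔ (==-⇔ (proj₁ (F p)) a) (==-⇔ (proj₂ (F p)) b)) (grid-enumerates n)
  exponent : ∀ a b → proj₂ (term ρ σ) a b ≡ length (fibre a b)
  exponent a b = trans
    (cong (λ xs → length (select (hits a b) xs))
      (trans (concatMap-map (λ i j → F (i , j)) (allFin n) (allFin n))
             (sym (map-cartesianProductWith F _,_ (allFin n) (allFin n)))))
    (trans (cong length (select-map (hits a b) F (grid n))) (Listₚ.length-map F (fibre a b)))
  counts : hasAllVars ρ σ ≡ true ⇔ (∀ a b → length (fibre a b) ≡ 1)
  counts = allL-⇔ (λ a → allL-⇔ (λ b → subst (λ k → (k ℕ.≡ᵇ 1) ≡ true ⇔ length (fibre a b) ≡ 1) (sym (exponent a b)) (≡ᵇ1 _)))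
    where
    ≡ᵇ1 : ∀ k → (k ℕ.≡ᵇ 1) ≡ true ⇔ k ≡ 1
    ≡ᵇ1 zero          = mk⇔ (λ ()) (λ ())
    ≡ᵇ1 (suc zero)    = mk⇔ (λ _ → refl) (λ _ → refl)
    ≡ᵇ1 (suc (suc k)) = mk⇔ (λ ()) (λ ())
  length-1 : ∀ xs → length xs ≡ 1 → {p q : Fin n × Fin n} → p ∈ xs → q ∈ xs → p ≡ q
  length-1 (x ∷ []) _ (here refl) (here refl) = refl

-- The sum over σ

twist : (Fin n → Fin n → Fin n) → Array n → Array n
twist κ σ = mk (λ i j → at σ i (κ i j))

at-twist : (κ : Fin n → Fin n → Fin n) (σ : Array n) → ∀ i j → at (twist κ σ) i j ≡ at σ i (κ i j)
at-twist κ σ = at-mk (λ i j → at σ i (κ i j))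

-- Composing each σ_i with κ_i multiplies the tail sign by the signs of the κ_i other than the
-- first. This one substitution serves both the vanishing of the sum (κ a transposition in one row)
-- and its factorization (κ the columns of ρ).
∑-twist : (κ : Fin (suc m) → Fin (suc m) → Fin (suc m)) → RowInj κ →
  {P Q : Array (suc m) → Set} {xs ys : List (Array (suc m))} →
  xs enumerates (λ σ → RowInj (at σ) × P σ) → ys enumerates (λ σ → RowInj (at σ) × Q σ) →
  (∀ σ → P (twist κ σ) → Q σ) → (∀ σ → Q σ → P (twist κ σ)) →
  ∑ xs (λ σ → tailRowsSign (at σ)) ≡ tailRowsSign κ * ∑ ys (λ σ → tailRowsSign (at σ))
∑-twist {m} κ κ-inj {P} {xs = xs} {ys} ex ey P⇒Q Q⇒P = trans
  (∑-reindex ey ex (twist κ) (twist κ⁻¹)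
    (λ σ (r , q) → twist-RowInj κ κ-inj σ r , Q⇒P σ q)
    (λ σ (r , p) → twist-RowInj κ⁻¹ (λ i → inv-Inj (κ i) (κ-inj i)) σ r ,
                   P⇒Q (twist κ⁻¹ σ) (subst P (sym (twist-twist κ κ⁻¹ (λ i → inv∘f (κ i) (κ-inj i)) σ)) p))
    (λ σ _ → twist-twist κ⁻¹ κ (λ i → f∘inv (κ i) (κ-inj i)) σ)
    (λ σ _ → twist-twist κ κ⁻¹ (λ i → inv∘f (κ i) (κ-inj i)) σ)
    (λ σ → tailRowsSign (at σ)) (λ σ → tailRowsSign κ * tailRowsSign (at σ))
    (λ σ _ → trans
      (∏-cong (allFin m) (λ i → trans (ε-cong (at-twist κ σ (suc i)))
        (trans (ε-∘ (at σ (suc i)) (κ (suc i)) (κ-inj (suc i))) (ℤₚ.*-comm (ε (at σ (suc i))) (ε (κ (suc i)))))))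
      (∏-* (allFin m) (λ i → ε (κ (suc i))) (λ i → ε (at σ (suc i))))))
  (∑-*ˡ (tailRowsSign κ) ys (λ σ → tailRowsSign (at σ)))
  where
  κ⁻¹ : Fin (suc m) → Fin (suc m) → Fin (suc m)
  κ⁻¹ i = inv (κ i)
  twist-RowInj : ∀ μ → RowInj μ → ∀ σ → RowInj (at σ) → RowInj (at (twist μ σ))
  twist-RowInj μ μ-inj σ r = RowInj-mk {f = λ i j → at σ i (μ i j)} (λ i → Inj-∘ (r i) (μ-inj i))
  twist-twist : ∀ μ ν → (∀ i j → ν i (μ i j) ≡ j) → ∀ σ → twist μ (twist ν σ) ≡ σ
  twist-twist μ ν νμ σ = mk-ext (λ i j → trans (at-twist ν σ i (μ i j)) (cong (at σ i) (νμ i j)))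

-- A repetition in a column other than the first, where exchanging two values of the corresponding
-- σ_i does change the sign.
Clash : (Fin (suc m) → Fin (suc m) → Fin (suc m)) → Set
Clash {m} r = ∃ λ (i : Fin m) → ∃ λ j → ∃ λ j′ → j ≢ j′ × r j (suc i) ≡ r j′ (suc i)

-- If all columns but the first are permutations, a symbol v repeated in rows j and j' of the
-- first column occurs m times in the other columns, in distinct rows other than j and j', but
-- only m - 1 such rows exist.
clash⊎Latin : (r : Fin (suc m) → Fin (suc m) → Fin (suc m)) → RowInj r → Clash r ⊎ Latin r
clash⊎Latin {m} r r-inj with Finₚ.any? {m} (λ i → Finₚ.any? (λ j → Finₚ.any? (λ j′ →
                                ¬? (j Finₚ.≟ j′) ×-dec (r j (suc i) Finₚ.≟ r j′ (suc i)))))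
... | yes clash = inj₁ clash
... | no ¬clash = inj₂ (r-inj , λ { zero → first ; (suc i) → other i })
  where
  other : ∀ i → Inj (λ j → r j (suc i))
  other i j j′ eq with j Finₚ.≟ j′
  ... | yes j≡j′ = j≡j′
  ... | no j≢j′  = contradiction (i , j , j′ , j≢j′ , eq) ¬clash
  first : Inj (λ j → r j zero)
  first j j′ eq with j Finₚ.≟ j′
  ... | yes j≡j′ = j≡j′
  ... | no j≢j′  = contradiction (Inj⇒surjective g g-inj j′) λ
    { (zero , j≡j′) → j≢j′ j≡j′
    ; (suc i , gi≡j′) → distinct j′ i (trans (cong (λ k → r k (suc i)) (sym gi≡j′)) (trans (g-spec i) eq)) }
    where
    v = r j zero
    -- `g` sends each column to a row where v stands. As an injective map it must reach j′, but row
    -- j′ already has v in the first column.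
    g : Fin (suc m) → Fin (suc m)
    g zero    = j
    g (suc i) = inv (λ k → r k (suc i)) v
    g-spec : ∀ i → r (g (suc i)) (suc i) ≡ v
    g-spec i = f∘inv (λ k → r k (suc i)) (other i) v
    distinct : ∀ k i → r k (suc i) ≢ r k zero
    distinct k i eq′ = contradiction (r-inj k _ _ eq′) λ ()
    g-inj : Inj g
    g-inj zero    zero    _   = refl
    g-inj zero    (suc i) eq′ = contradiction (trans (cong (λ k → r k (suc i)) eq′) (g-spec i)) (distinct j i)
    g-inj (suc i) zero    eq′ = contradiction (trans (cong (λ k → r k (suc i)) (sym eq′)) (g-spec i)) (distinct j i)
    g-inj (suc i) (suc l) eq′ = r-inj (g (suc i)) _ _
      (trans (g-spec i) (sym (trans (cong (λ k → r k (suc l)) eq′) (g-spec l))))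

∏-single : (f : Fin m → ℤ) (c : ℤ) (i : Fin m) → f i ≡ c → (∀ j → j ≢ i → f j ≡ 1ℤ) → ∏ (allFin m) f ≡ c
∏-single {suc m} f c zero fi others = begin
  ∏ (allFin (suc m)) f             ≡⟨ ∏-allFin-suc f ⟩
  f zero * ∏ (allFin m) (f ∘ suc)  ≡⟨ cong₂ _*_ fi (trans (∏-cong (allFin m) (λ j → others (suc j) λ ())) (∏-1 (allFin m))) ⟩
  c * 1ℤ                           ≡⟨ ℤₚ.*-identityʳ c ⟩
  c                                ∎
  where open ≡-Reasoning
∏-single {suc m} f c (suc i) fi others = begin
  ∏ (allFin (suc m)) f             ≡⟨ ∏-allFin-suc f ⟩
  f zero * ∏ (allFin m) (f ∘ suc)  ≡⟨ cong₂ _*_ (others zero λ ()) (∏-single (f ∘ suc) c i fi (λ j j≢i → others (suc j) (j≢i ∘ Finₚ.suc-injective))) ⟩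
  1ℤ * c                           ≡⟨ ℤₚ.*-identityˡ c ⟩
  c                                ∎
  where open ≡-Reasoning

x≡-x⇒x≡0 : ∀ x → x ≡ -1ℤ * x → x ≡ 0ℤ
x≡-x⇒x≡0 (+ zero)       _ = refl
x≡-x⇒x≡0 (+ suc k)      ()
x≡-x⇒x≡0 (ℤ.-[1+ k ])   ()

module _ (ρ : Array (suc m)) where
  private
    monomials = select (hasAllVars ρ) (vecsOver (Sym (suc m)) (suc m))
    monomials-enumerates : monomials enumerates (λ σ → RowInj (at σ) × Orthogonal (at ρ) (at σ))
    monomials-enumerates = select-enumerates (hasAllVars-⇔ ρ) (tuples-enumerates (suc m))

  -- Exchanging the values of σ at positions j and j′ of row `suc i` only exchanges two variables
  -- with the same second index, so the monomial survives; the sign flips, and the sum equals its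
  -- own negative.
  ∑-σ-clash : Clash (at ρ) → ∑ monomials (λ σ → tailRowsSign (at σ)) ≡ 0ℤ
  ∑-σ-clash (i , j , j′ , j≢j′ , clash) = x≡-x⇒x≡0 _
    (trans (∑-twist κ κ-inj monomials-enumerates monomials-enumerates untwist twisted)
           (cong (_* ∑ monomials (λ σ → tailRowsSign (at σ))) κ-sign))
    where
    κ : Fin (suc m) → Fin (suc m) → Fin (suc m)
    κ l with l Finₚ.≟ suc i
    ... | yes _ = transposition j j′
    ... | no _  = id
    κ-involutive : ∀ l k → κ l (κ l k) ≡ k
    κ-involutive l k with l Finₚ.≟ suc i
    ... | yes _ = transposition-involutive j j′ k
    ... | no _  = refl
    κ-inj : RowInj κ
    κ-inj l = involutive⇒Inj (κ-involutive l)
    ρ∘κ : ∀ l k → at ρ (κ l k) l ≡ at ρ k l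
    ρ∘κ l k with l Finₚ.≟ suc i
    ... | no _     = refl
    ... | yes refl with k Finₚ.≟ j | k Finₚ.≟ j′
    ...   | yes refl | _        = sym clash
    ...   | no _     | yes refl = clash
    ...   | no _     | no _     = refl
    κ-sign : tailRowsSign κ ≡ -1ℤ
    κ-sign = ∏-single (λ l → ε (κ (suc l))) -1ℤ i at-i not-i
      where
      at-i : ε (κ (suc i)) ≡ -1ℤ
      at-i with i Finₚ.≟ i
      ... | yes _  = ε-transposition j≢j′
      ... | no i≢i = contradiction refl i≢i
      not-i : ∀ l → l ≢ i → ε (κ (suc l)) ≡ 1ℤ
      not-i l l≢i with l Finₚ.≟ i
      ... | yes l≡i = contradiction l≡i l≢i
      ... | no _    = ε-id {suc m}
    twisted : ∀ σ → Orthogonal (at ρ) (at σ) → Orthogonal (at ρ) (at (twist κ σ))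
    twisted σ orth l k l′ k′ eqσ eqρ =
      let (l≡l′ , κk≡κk′) = orth l (κ l k) l′ (κ l′ k′)
                              (trans (sym (at-twist κ σ l k)) (trans eqσ (at-twist κ σ l′ k′)))
                              (trans (ρ∘κ l k) (trans eqρ (sym (ρ∘κ l′ k′))))
      in l≡l′ , cancel l≡l′ κk≡κk′
      where
      cancel : l ≡ l′ → κ l k ≡ κ l′ k′ → k ≡ k′
      cancel refl = κ-inj l k k′
    -- Since κ is an involution, this is `twisted` applied to `twist κ σ`.
    untwist : ∀ σ → Orthogonal (at ρ) (at (twist κ σ)) → Orthogonal (at ρ) (at σ)
    untwist σ orth = subst (Orthogonal (at ρ) ∘ at)
      (mk-ext {M = σ} (λ l k → trans (at-twist κ σ l (κ l k)) (cong (at σ l) (κ-involutive l k))))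
      (twisted (twist κ σ) orth)

  -- With κ_i the i-th column of ρ, the variable of cell (i, j) becomes the one indexed by (σ_i(b),
  -- b) with b = κ_i(j). Distinctness of these pairs says that the values σ_i(b) differ for fixed b,
  -- which is injectivity of column b of σ.
  ∑-σ-Latin : Latin (at ρ) →
    ∑ monomials (λ σ → tailRowsSign (at σ)) ≡
    tailColsSign (at ρ) * ∑ (LatinSquares (suc m)) (λ σ → tailRowsSign (at σ))
  ∑-σ-Latin (r , c) = ∑-twist κ c monomials-enumerates (LatinSquares-enumerates (suc m)) untwist twisted
    where
    κ : Fin (suc m) → Fin (suc m) → Fin (suc m)
    κ i j = at ρ j i
    untwist : ∀ σ → Orthogonal (at ρ) (at (twist κ σ)) → ColInj (at σ)
    untwist σ orth j i i′ eq = proj₁ (orth i (inv (κ i) j) i′ (inv (κ i′) j)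
      (trans (at-twist κ σ i _) (trans (cong (at σ i) (f∘inv (κ i) (c i) j))
        (trans eq (sym (trans (at-twist κ σ i′ _) (cong (at σ i′) (f∘inv (κ i′) (c i′) j)))))))
      (trans (f∘inv (κ i) (c i) j) (sym (f∘inv (κ i′) (c i′) j))))
    twisted : ∀ σ → ColInj (at σ) → Orthogonal (at ρ) (at (twist κ σ))
    twisted σ col i j i′ j′ eqσ eqρ = i≡i′ , c i′ j j′ (trans (cong (at ρ j) (sym i≡i′)) eqρ)
      where
      i≡i′ : i ≡ i′
      i≡i′ = col (κ i j) i i′ (trans (sym (at-twist κ σ i j))
        (trans eqσ (trans (at-twist κ σ i′ j′) (cong (at σ i′) (sym eqρ)))))

-- Coefficients

toℚᵘ-/1 : ∀ z → toℚᵘ (z ℚ./ 1) ≃ᵘ mkℚᵘ z 0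
toℚᵘ-/1 z = ℚₚ.toℚᵘ-fromℚᵘ (mkℚᵘ z 0)

-- Before scaling all coefficients are integers; this moves their summation into ℤ, where the
-- combinatorial sums live.
/1-+ : ∀ y z → y ℚ./ 1 ℚ.+ z ℚ./ 1 ≡ (y + z) ℚ./ 1
/1-+ y z = ℚₚ.toℚᵘ-injective (begin
  toℚᵘ (y ℚ./ 1 ℚ.+ z ℚ./ 1)         ≈⟨ ℚₚ.toℚᵘ-homo-+ (y ℚ./ 1) (z ℚ./ 1) ⟩
  toℚᵘ (y ℚ./ 1) +ᵘ toℚᵘ (z ℚ./ 1)   ≈⟨ ℚᵘₚ.+-cong (toℚᵘ-/1 y) (toℚᵘ-/1 z) ⟩
  mkℚᵘ y 0 +ᵘ mkℚᵘ z 0               ≈⟨ *≡* (lem y z) ⟩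
  mkℚᵘ (y + z) 0                     ≈⟨ ℚᵘₚ.≃-sym (toℚᵘ-/1 (y + z)) ⟩
  toℚᵘ ((y + z) ℚ./ 1)               ∎)
  where
  open ≃-Reasoning ℚᵘₚ.≃-setoid
  lem : ∀ y z → (y * 1ℤ + z * 1ℤ) * 1ℤ ≡ (y + z) * 1ℤ
  lem = solve-∀

1/d*d*z : ∀ d .{{_ : NonZero d}} z → (1ℤ ℚ./ d) ℚ.* ((+ d * z) ℚ./ 1) ≡ z ℚ./ 1
1/d*d*z d@(suc d-1) z = ℚₚ.toℚᵘ-injective (begin
  toℚᵘ ((1ℤ ℚ./ d) ℚ.* ((+ d * z) ℚ./ 1))       ≈⟨ ℚₚ.toℚᵘ-homo-* (1ℤ ℚ./ d) ((+ d * z) ℚ./ 1) ⟩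
  toℚᵘ (1ℤ ℚ./ d) *ᵘ toℚᵘ ((+ d * z) ℚ./ 1)     ≈⟨ ℚᵘₚ.*-cong (ℚₚ.toℚᵘ-fromℚᵘ (mkℚᵘ 1ℤ d-1)) (toℚᵘ-/1 (+ d * z)) ⟩
  mkℚᵘ 1ℤ d-1 *ᵘ mkℚᵘ (+ d * z) 0               ≈⟨ *≡* (trans (lem (+ d) z) (cong (λ k → z * + k) (sym (ℕₚ.*-identityʳ d)))) ⟩
  mkℚᵘ z 0                                      ≈⟨ ℚᵘₚ.≃-sym (toℚᵘ-/1 z) ⟩
  toℚᵘ (z ℚ./ 1)                                ∎)
  where
  open ≃-Reasoning ℚᵘₚ.≃-setoid
  lem : ∀ d z → (1ℤ * (d * z)) * 1ℤ ≡ z * d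
  lem = solve-∀

sumℚ-++ : ∀ xs ys → sumℚ (xs ++ ys) ≡ sumℚ xs ℚ.+ sumℚ ys
sumℚ-++ []       ys = sym (ℚₚ.+-identityˡ _)
sumℚ-++ (x ∷ xs) ys = trans (cong (x ℚ.+_) (sumℚ-++ xs ys)) (sym (ℚₚ.+-assoc x _ _))

coeff-++ : (p q : Poly n) (e : Monomial n) → coeff (p ++ q) e ≡ coeff p e ℚ.+ coeff q e
coeff-++ p q e = trans (cong (sumℚ ∘ map proj₁) (select-++ p))
  (trans (cong sumℚ (Listₚ.map-++ proj₁ (select here? p) _)) (sumℚ-++ (map proj₁ (select here? p)) _))
  where
  here? = λ t → sameMonomial (proj₂ t) e
  select-++ : ∀ p → select here? (p ++ q) ≡ select here? p ++ select here? q
  select-++ []      = refl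
  select-++ (t ∷ p) with here? t
  ... | true  = cong (t ∷_) (select-++ p)
  ... | false = select-++ p

coeff-scale : (c : ℚ) (p : Poly n) (e : Monomial n) → coeff (scale c p) e ≡ c ℚ.* coeff p e
coeff-scale c []      e = sym (ℚₚ.*-zeroʳ c)
coeff-scale c (t ∷ p) e with sameMonomial (proj₂ t) e
... | true  = trans (cong (c ℚ.* proj₁ t ℚ.+_) (coeff-scale c p e)) (sym (ℚₚ.*-distribˡ-+ c (proj₁ t) _))
... | false = coeff-scale c p e

module _ (w : X → ℤ) (mono : X → Monomial n) (e : Monomial n) where

  coeff-map : ∀ xs → coeff (map (λ x → w x ℚ./ 1 , mono x) xs) e ≡
                     ∑ (select (λ x → sameMonomial (mono x) e) xs) w ℚ./ 1
  coeff-map []       = refl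
  coeff-map (x ∷ xs) with sameMonomial (mono x) e
  ... | true  = trans (cong (w x ℚ./ 1 ℚ.+_) (coeff-map xs)) (/1-+ (w x) _)
  ... | false = coeff-map xs

coeff-concatMap : (p : X → Poly n) (e : Monomial n) (w : X → ℤ) → (∀ x → coeff (p x) e ≡ w x ℚ./ 1) →
  ∀ xs → coeff (concatMap p xs) e ≡ ∑ xs w ℚ./ 1
coeff-concatMap p e w eq []       = refl
coeff-concatMap p e w eq (x ∷ xs) = trans (coeff-++ (p x) (concatMap p xs) e)
  (trans (cong₂ ℚ._+_ (eq x) (coeff-concatMap p e w eq xs)) (/1-+ (w x) (∑ xs w)))

-- The coefficient as a product of two signed sums

module _ (m : ℕ) where
  private
    N = suc m
    tuples : List (Array N)
    tuples = vecsOver (Sym N) N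

  termSign : Array N → Array N → ℤ
  termSign ρ σ = signFirst σ * signTuple σ * signTuple ρ

  -- The sign of σ_1 occurs once in `signFirst` and once in `signTuple`, and its square is 1.
  termSign≡ : ∀ ρ σ → RowInj (at ρ) → RowInj (at σ) → termSign ρ σ ≡ rowsSign (at ρ) * tailRowsSign (at σ)
  termSign≡ ρ σ rρ rσ = begin
    termSign ρ σ
      ≡⟨ cong₂ _*_ (cong₂ _*_ first (trans (signTuple≡rowsSign σ rσ) (∏-allFin-suc (λ i → ε (at σ i))))) (signTuple≡rowsSign ρ rρ) ⟩
    ε₀ * (ε₀ * tailRowsSign (at σ)) * rowsSign (at ρ)
      ≡⟨ lem ε₀ (tailRowsSign (at σ)) (rowsSign (at ρ)) ⟩
    ε₀ * ε₀ * (rowsSign (at ρ) * tailRowsSign (at σ))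
      ≡⟨ trans (cong (_* (rowsSign (at ρ) * tailRowsSign (at σ))) (unit-² (ε-unit (rσ zero)))) (ℤₚ.*-identityˡ _) ⟩
    rowsSign (at ρ) * tailRowsSign (at σ) ∎
    where
    open ≡-Reasoning
    ε₀ = ε (at σ zero)
    lem : ∀ e t r → e * (e * t) * r ≡ e * e * (r * t)
    lem = solve-∀
    isFirst-suc : select (isFirst {N}) (List.tabulate suc) ≡ []
    isFirst-suc = trans (cong (select isFirst) (sym (Listₚ.map-tabulate id suc)))
      (trans (select-map isFirst suc (allFin m)) (cong (map suc) (select-false (allFin m))))
    first : signFirst σ ≡ ε₀
    first = trans (cong (λ is → sign (lookup σ zero) * ∏ is (λ i → sign (lookup σ i))) isFirst-suc)
      (trans (ℤₚ.*-identityʳ _) (sign≡ε (lookup σ zero) (rσ zero)))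

  coeff-thePoly : coeff (thePoly N) (allVars N) ≡
    invNormConst N ℚ.*
    (∑ (select firstIsId tuples) (λ ρ → ∑ (select (hasAllVars ρ) tuples) (termSign ρ)) ℚ./ 1)
  coeff-thePoly = trans (coeff-scale (invNormConst N) (concatMap (λ ρ → map (term ρ) tuples) (select firstIsId tuples)) (allVars N))
    (cong (invNormConst N ℚ.*_) (coeff-concatMap (λ ρ → map (term ρ) tuples) (allVars N)
      (λ ρ → ∑ (select (hasAllVars ρ) tuples) (termSign ρ))
      (λ ρ → coeff-map (termSign ρ) (proj₂ ∘ term ρ) (allVars N) tuples) (select firstIsId tuples)))

  ∑-ρσ : ∑ (select firstIsId tuples) (λ ρ → ∑ (select (hasAllVars ρ) tuples) (termSign ρ)) ≡
         ∑ (normalized m) (λ L → rowsSign (at L) * tailColsSign (at L)) *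
         ∑ (LatinSquares N) (λ L → tailRowsSign (at L))
  ∑-ρσ = begin
    ∑ W (λ ρ → ∑ (select (hasAllVars ρ) tuples) (termSign ρ))
      ≡⟨ ∑-cong W (λ {ρ} ρ∈ → inner ρ (proj₁ (sound W-enumerates ρ∈))) ⟩
    ∑ W (λ ρ → if isLatinᵇ ρ then w ρ * S else 0ℤ)
      ≡⟨ sym (∑-select isLatinᵇ W (λ ρ → w ρ * S)) ⟩
    ∑ (select isLatinᵇ W) (λ ρ → w ρ * S)
      ≡⟨ ∑-↭ (λ ρ → w ρ * S) (enumerates⇒↭
           (enumerates-⇔ (λ _ → mk⇔ (λ ((_ , fst) , lat) → lat , fst) (λ (lat , fst) → (proj₁ lat , fst) , lat))
             (select-enumerates isLatinᵇ-⇔ W-enumerates))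
           (normalized-enumerates m)) ⟩
    ∑ (normalized m) (λ ρ → w ρ * S)
      ≡⟨ ∑-*ʳ S (normalized m) w ⟩
    ∑ (normalized m) w * S ∎
    where
    open ≡-Reasoning
    W = select firstIsId tuples
    S = ∑ (LatinSquares N) (λ L → tailRowsSign (at L))
    w : Array N → ℤ
    w L = rowsSign (at L) * tailColsSign (at L)
    W-enumerates : W enumerates (λ ρ → RowInj (at ρ) × FirstRowId (at ρ))
    -- On arrays, `firstIsId` and `isNormalized` unfold to the same test.
    W-enumerates = select-enumerates isNormalized-⇔ (tuples-enumerates N)
    factor : ∀ ρ → RowInj (at ρ) → ∑ (select (hasAllVars ρ) tuples) (termSign ρ) ≡
             rowsSign (at ρ) * ∑ (select (hasAllVars ρ) tuples) (λ σ → tailRowsSign (at σ))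
    factor ρ r = trans
      (∑-cong (select (hasAllVars ρ) tuples) (λ {σ} σ∈ →
        termSign≡ ρ σ r (sound (tuples-enumerates N) (proj₁ (∈-select⁻ (hasAllVars ρ) tuples σ∈)))))
      (∑-*ˡ (rowsSign (at ρ)) (select (hasAllVars ρ) tuples) (λ σ → tailRowsSign (at σ)))
    inner : ∀ ρ → RowInj (at ρ) → ∑ (select (hasAllVars ρ) tuples) (termSign ρ) ≡ (if isLatinᵇ ρ then w ρ * S else 0ℤ)
    inner ρ r with isLatinᵇ ρ in eq
    ... | true  = trans (factor ρ r) (trans (cong (rowsSign (at ρ) *_) (∑-σ-Latin ρ (to (isLatinᵇ-⇔ ρ) eq)))
                    (sym (ℤₚ.*-assoc (rowsSign (at ρ)) (tailColsSign (at ρ)) S)))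
    ... | false with clash⊎Latin (at ρ) r
    ...   | inj₁ clash = trans (factor ρ r) (trans (cong (rowsSign (at ρ) *_) (∑-σ-clash ρ clash)) (ℤₚ.*-zeroʳ (rowsSign (at ρ))))
    ...   | inj₂ lat   = contradiction (trans (sym eq) (from (isLatinᵇ-⇔ ρ) lat)) λ ()

-- Constants, parity and conclusion

normConst-nonZero : ∀ n → NonZero (normConst n)
normConst-nonZero n = ℕₚ.m*n≢0 (n ! ℕ.* (n ∸ 1) !) ((n ∸ 1) !)
  {{ℕₚ.m*n≢0 (n !) ((n ∸ 1) !) {{n ℕₚ.!≢0}} {{(n ∸ 1) ℕₚ.!≢0}}}} {{(n ∸ 1) ℕₚ.!≢0}}

triangular*2 : ∀ m → triangular (suc m) ℕ.* 2 ≡ suc m ℕ.* m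
triangular*2 zero    = refl
triangular*2 (suc m) = trans (ℕₚ.*-distribʳ-+ 2 (suc m) (triangular (suc m)))
  (trans (cong (suc m ℕ.* 2 ℕ.+_) (triangular*2 m)) (lem m))
  where
  lem : ∀ m → suc m ℕ.* 2 ℕ.+ suc m ℕ.* m ≡ suc (suc m) ℕ.* suc m
  lem = ℕ-Solver.solve-∀

unit-^-even : ∀ k {z} → Unit z → z ^ (k ℕ.* 2) ≡ 1ℤ
unit-^-even zero    u = refl
unit-^-even (suc k) {z} u = trans (sym (ℤₚ.*-assoc z z _)) (cong₂ _*_ (unit-² u) (unit-^-even k u))

module _ (m : ℕ) (m-even : ∀ {z} → Unit z → z ^ m ≡ 1ℤ) where

  theorem7-suc : coeff (thePoly (suc m)) (allVars (suc m)) ≡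
    ((-1ℤ ^ ((suc m ℕ.* m) / 2)) * AT (suc m) * (+ R-E (suc m) ℤ.- + R-O (suc m))) ℚ./ 1
  theorem7-suc = trans (coeff-thePoly m)
    (trans (cong (λ z → invNormConst (suc m) ℚ.* (z ℚ./ 1)) total) (1/d*d*z (normConst (suc m)) {{normConst-nonZero (suc m)}} (κ * AT (suc m) * R)))
    where
    open ≡-Reasoning
    κ = -1ℤ ^ ((suc m ℕ.* m) / 2)
    R = + R-E (suc m) ℤ.- + R-O (suc m)
    regroup : ∀ f g k r a → (g * r) * (f * (k * (g * a))) ≡ (f * g) * g * (k * a * r)
    regroup = solve-∀
    stabilizer-! : length (stabilizer m) ≡ m !
    stabilizer-! = trans (length-stabilizer m) (length-Sym m)
    κ≡ : -1ℤ ^ triangular (suc m) ≡ κ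
    κ≡ = cong (-1ℤ ^_) (trans (sym (m*n/n≡m (triangular (suc m)) 2)) (cong (_/ 2) (triangular*2 m)))
    total : ∑ (select firstIsId (vecsOver (Sym (suc m)) (suc m)))
              (λ ρ → ∑ (select (hasAllVars ρ) (vecsOver (Sym (suc m)) (suc m))) (termSign m ρ)) ≡
            + normConst (suc m) * (κ * AT (suc m) * R)
    total = begin
      _ ≡⟨ ∑-ρσ m ⟩
      ∑ (normalized m) (λ L → rowsSign (at L) * tailColsSign (at L)) * ∑ (LatinSquares (suc m)) (λ L → tailRowsSign (at L))
        ≡⟨ cong₂ _*_
             (trans (∑-normalized-reduced m m-even) (cong₂ _*_ (cong +_ stabilizer-!) (sym (R-E-R-O m))))
             (trans (∑-LatinSquares m m-even) (cong₂ _*_ (cong +_ (length-Sym (suc m)))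
               (trans (∑-normalized-conj m) (cong₂ _*_ κ≡
                 (trans (∑-diagFirst m) (cong₂ _*_ (cong +_ stabilizer-!) (sym (AT≡ m)))))))) ⟩
      (+ (m !) * R) * (+ (suc m !) * (κ * (+ (m !) * AT (suc m))))
        ≡⟨ regroup (+ (suc m !)) (+ (m !)) κ R (AT (suc m)) ⟩
      (+ (suc m !) * + (m !)) * + (m !) * (κ * AT (suc m) * R)
        ≡⟨ cong (_* (κ * AT (suc m) * R)) (sym (trans (ℤₚ.pos-* (suc m ! ℕ.* m !) (m !)) (cong (_* + (m !)) (ℤₚ.pos-* (suc m !) (m !))))) ⟩
      + normConst (suc m) * (κ * AT (suc m) * R) ∎

theorem7 : (n : ℕ) → n % 2 ≡ 1 →
    coeff (thePoly n) (allVars n)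
    ≡ ((-1ℤ ℤ.^ ((n ℕ.* (n ∸ 1)) / 2)) ℤ.* AT n ℤ.* ((+ R-E n) ℤ.- (+ R-O n))) ℚ./ 1
theorem7 n n%2≡1 = subst
  (λ n → coeff (thePoly n) (allVars n)
    ≡ ((-1ℤ ℤ.^ ((n ℕ.* (n ∸ 1)) / 2)) ℤ.* AT n ℤ.* ((+ R-E n) ℤ.- (+ R-O n))) ℚ./ 1)
  -- The remainder 1 provides the successor: n is `suc m` with m twice `n / 2`, hence even.
  (sym (trans (m≡m%n+[m/n]*n n 2) (cong (ℕ._+ n / 2 ℕ.* 2) n%2≡1)))
  (theorem7-suc (n / 2 ℕ.* 2) (unit-^-even (n / 2)))
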